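{- Let $d \geq 3$ and $1 \leq j \leq d$ be integers, let $e\in\{0,\frac12,1,\frac32,2\}$, and let $q$ be a prime power, which is moreover the square of a prime power if $e\in\{\frac12,\frac32\}$. Then: (i) $|C_j(1)| = \max\{ |C_j(i)| : 1 \leq i \leq d \}$ if $e > 1$ or $(j,e) = (d,1)$. (ii) $|C_j(d)| = \max\{ |C_j(i)| : 1 \leq i \leq d \}$ if $e \leq 1$. (iii) If $j < d$ is odd, then $C_j(d) = \min\{ C_j(i) : 0 \leq i \leq d \}$.
   Context: With Gaussian coefficients $\genfrac{[}{]}{0pt}{}{a}{m} = \prod_{h=0}^{m-1}\frac{q^{a-h}-1}{q^{m-h}-1}$ (and $0$ if $m<0$), for $0\le i,j\le d$, $$C_j(i) = \sum_{h=\max(i-j, 0)}^{\min(d-j,i)} (-1)^{i-h} \, q^{\binom{i-h}{2} + \binom{j-i+h}{2} + (j-i+h) e} \genfrac{[}{]}{0pt}{}{d-i}{d-j-h} \genfrac{[}{]}{0pt}{}{i}{h}.$$ The numbers $C_j(i)$, $0\le i\le d$, are the eigenvalues of the distance-$j$ graph of the dual polar graph $C_q(d,e)$, whose vertices are the maximal totally isotropic (singular) subspaces of a finite classical polar space of rank $d$ over $\mathbb{F}_q$ with parameter $e$ ($e=1,1,0,2,\frac12,\frac32$ for types $C_d(q)$, $B_d(q)$, $D_d(q)$, ${}^2D_{d+1}(q)$, ${}^2A_{2d}(q)$, ${}^2A_{2d-1}(q)$ respectively), two vertices being adjacent when they meet in codimension 1. -}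

module Defs where

open import Data.Integer as ℤ using (ℤ; +_; -1ℤ)
open import Data.List using (List; []; _∷_; foldr; tabulate; applyUpTo)
open import Data.Fin using (Fin; toℕ)
open import Data.Fin.Properties using (toℕ<n)
open import Data.Nat
open import Data.Nat.Combinatorics using (_C_)
open import Data.Nat.Primality using (Prime; prime⇒nonTrivial)
open import Data.Nat.Properties
open import Data.Product using (_×_; ∃-syntax)
open import Data.Rational as ℚ using (ℚ; 0ℚ; 1ℚ; ½; ↥_)
open import Relation.Binary.PropositionalEquality using (_≡_; refl)
open import Relation.Nullary using (yes; no)
open import Relation.Unary using (Pred)
open import Level using (0ℓ)

record IsPrimePower (q : ℕ) : Set where
  field
    p k : ℕ
    isPrime : Prime p
    1≤k : 1 ≤ k
    q≡p^k : q ≡ p ^ k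

IsSquareOfPrimePower : ℕ → Set
IsSquareOfPrimePower q = ∃[ r ] (IsPrimePower r × q ≡ r ^ 2)

1<q^n : ∀ q .{{_ : NonTrivial q}} {n} → 1 ≤ n → 1 < q ^ n
1<q^n q 1≤n = ^-monoʳ-< q (nonTrivial⇒n>1 q) 1≤n

isPrimePower⇒nonTrivial : ∀ {q} → IsPrimePower q → NonTrivial q
isPrimePower⇒nonTrivial record { p = p ; isPrime = pr ; 1≤k = 1≤k ; q≡p^k = refl } =
  n>1⇒nonTrivial (1<q^n p {{prime⇒nonTrivial pr}} 1≤k)

3/2 2ℚ : ℚ
3/2 = + 3 ℚ./ 2
2ℚ  = + 2 ℚ./ 1

polarParameters : List ℚ
polarParameters = 0ℚ ∷ ½ ∷ 1ℚ ∷ 3/2 ∷ 2ℚ ∷ []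

-- The natural number 2e, for e a nonnegative element of ½ℤ.
doubled : ℚ → ℕ
doubled e = ℤ.∣ ↥ (2ℚ ℚ.* e) ∣

-- Integer square root ⌊√n⌋.
√_ : ℕ → ℕ
√ zero = zero
√ suc n with suc (√ n) * suc (√ n) ≤? suc n
... | yes _ = suc (√ n)
... | no  _ = √ n

-- q ^½ n is q^(n/2); the root is exact when n is even or q is a perfect square.
-- For the exponents arising in C_j(i), n is even if e is an integer, and q is
-- assumed to be a square otherwise.
_^½_ : ℕ → ℕ → ℕ
q ^½ n = √ (q ^ n)

q^n∸1-nonZero : ∀ q .{{_ : NonTrivial q}} {n} → 1 ≤ n → NonZero (q ^ n ∸ 1)
q^n∸1-nonZero q 1≤n = >-nonZero (m<n⇒0<n∸m (1<q^n q 1≤n))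

-- For h > a the truncated exponent a ∸ h differs from a - h, but then the
-- factor at h = a already makes the product vanish.
gaussian : (q : ℕ) .{{_ : NonTrivial q}} → ℕ → ℕ → ℚ
gaussian q a m = foldr ℚ._*_ 1ℚ (tabulate factor)
  where
  factor : Fin m → ℚ
  factor h = ℚ._/_ (+ (q ^ (a ∸ toℕ h) ∸ 1)) (q ^ (m ∸ toℕ h) ∸ 1)
    {{q^n∸1-nonZero q (m<n⇒0<n∸m (toℕ<n h))}}

∑[_⋯_] : ℕ → ℕ → (ℕ → ℚ) → ℚ
∑[ lo ⋯ hi ] f = foldr ℚ._+_ 0ℚ (applyUpTo (λ k → f (lo + k)) (suc hi ∸ lo))

-- C_j(i).  Throughout the summation range h ≤ i, h ≤ d - j and i ≤ j + h, so
-- none of the truncated subtractions in a summand truncates when i , j ≤ d.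
-- The exponent of q is doubled, since e may be a half-integer.
eigenvalue : (d : ℕ) (e : ℚ) (q : ℕ) .{{_ : NonTrivial q}} → (j i : ℕ) → ℚ
eigenvalue d e q j i = ∑[ (i ∸ j) ⊔ 0 ⋯ (d ∸ j) ⊓ i ] λ h →
  ((-1ℤ ℤ.^ (i ∸ h)) ℤ.*
    + (q ^½ (2 * (((i ∸ h) C 2) + ((j + h ∸ i) C 2)) + (j + h ∸ i) * doubled e)))
    ℚ./ 1
  ℚ.* gaussian q (d ∸ i) (d ∸ j ∸ h)
  ℚ.* gaussian q i h

Values : (ℕ → ℚ) → ℕ → ℕ → Pred ℚ 0ℓ
Values f lo hi x = ∃[ i ] (lo ≤ i × i ≤ hi × x ≡ f i)

IsMax : Pred ℚ 0ℓ → ℚ → Set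
IsMax S m = S m × (∀ x → S x → x ℚ.≤ m)

IsMin : Pred ℚ 0ℓ → ℚ → Set
IsMin S m = S m × (∀ x → S x → m ℚ.≤ x)

{-# OPTIONS --safe #-}
module Submission where

-- By the q-binomial theorem C_j(i) is the coefficient of t^(d-j) in
--   ∏_{k<i} (t - q^k) · ∏_{k<d-i} (t + q^(e+k)),
-- an elementary symmetric polynomial of degree j. For i = d all roots have the same
-- sign, so |C_j(d)| is its value at 1, q, …, q^(d-1), and this dominates |C_j(i)| as
-- soon as e ≤ i, which holds for i ≥ 1 if e ≤ 1, and for i ≥ 2 always.
-- If e > 1 then C_j(1) = e_j(T) - e_(j-1)(T) with T = {q^e, …, q^(e+d-2)}, and
-- e_j(T) ≥ 2 e_(j-1)(T) for j < d. In particular C_j(1) ≥ 0, which settles i = 1 in (iii).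
-- For i ≥ 2 the factors of C_j(i) other than t - 1 match the elements of T so that
-- each is at most half its partner (2q ≤ q^e), which yields (i).

open import Defs
open import Data.Integer as ℤ using (ℤ; +_; -_; -1ℤ; 0ℤ; 1ℤ)
import Data.Integer.Properties as ℤₚ
import Data.Integer.Tactic.RingSolver as ℤ-Solver
open import Data.List using (List; []; _∷_; _++_; map; length; foldr; applyUpTo)
open import Data.List.Membership.Propositional using (_∈_)
open import Data.List.Properties using (length-map; ++-identityʳ)
open import Data.List.Relation.Binary.Pointwise using (Pointwise; []; _∷_; ++⁺)
open import Data.List.Relation.Unary.Any using (here; there)
open import Data.Nat
open import Data.Nat.Combinatorics using (nC1≡n; nCk+nC[k+1]≡[n+1]C[k+1]) renaming (_C_ to _choose_)
open import Data.Nat.Divisibility using (_∣_; divides)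
open import Data.Nat.Properties
open import Data.Nat.Tactic.RingSolver using (solve-∀)
open import Data.Product using (_×_; _,_)
open import Data.Rational as ℚ using (ℚ; 0ℚ; 1ℚ; ½; ∣_∣)
import Data.Rational.Properties as ℚₚ
open import Data.Rational.Solver using (module +-*-Solver)
open import Data.Rational.Unnormalised as ℚᵘ using (mkℚᵘ; *≡*)
import Data.Rational.Unnormalised.Properties as ℚᵘₚ
open import Data.Sum using (_⊎_; inj₁; inj₂)
open import Relation.Binary.PropositionalEquality
open import Relation.Nullary using (yes; no; ¬_; contradiction)
open import Relation.Nullary.Decidable using (from-no)

-- Integers in ℚ

fromℤ : ℤ → ℚ
fromℤ z = z ℚ./ 1

toℚᵘ-fromℤ : ∀ z → ℚ.toℚᵘ (fromℤ z) ℚᵘ.≃ mkℚᵘ z 0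
toℚᵘ-fromℤ z = ℚₚ.toℚᵘ-fromℚᵘ (mkℚᵘ z 0)

fromℤ-+ : ∀ x y → fromℤ (x ℤ.+ y) ≡ fromℤ x ℚ.+ fromℤ y
fromℤ-+ x y = ℚₚ.toℚᵘ-injective (begin
  ℚ.toℚᵘ (fromℤ (x ℤ.+ y))                   ≈⟨ toℚᵘ-fromℤ (x ℤ.+ y) ⟩
  mkℚᵘ (x ℤ.+ y) 0                           ≈⟨ *≡* (cong (ℤ._* 1ℤ) (sym (cong₂ ℤ._+_ (ℤₚ.*-identityʳ x) (ℤₚ.*-identityʳ y)))) ⟩
  mkℚᵘ x 0 ℚᵘ.+ mkℚᵘ y 0                     ≈⟨ ℚᵘₚ.+-cong (toℚᵘ-fromℤ x) (toℚᵘ-fromℤ y) ⟨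
  ℚ.toℚᵘ (fromℤ x) ℚᵘ.+ ℚ.toℚᵘ (fromℤ y)     ≈⟨ ℚₚ.toℚᵘ-homo-+ (fromℤ x) (fromℤ y) ⟨
  ℚ.toℚᵘ (fromℤ x ℚ.+ fromℤ y)               ∎)
  where open ℚᵘₚ.≃-Reasoning

fromℤ-* : ∀ x y → fromℤ (x ℤ.* y) ≡ fromℤ x ℚ.* fromℤ y
fromℤ-* x y = ℚₚ.toℚᵘ-injective (begin
  ℚ.toℚᵘ (fromℤ (x ℤ.* y))                   ≈⟨ toℚᵘ-fromℤ (x ℤ.* y) ⟩
  mkℚᵘ x 0 ℚᵘ.* mkℚᵘ y 0                     ≈⟨ ℚᵘₚ.*-cong (toℚᵘ-fromℤ x) (toℚᵘ-fromℤ y) ⟨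
  ℚ.toℚᵘ (fromℤ x) ℚᵘ.* ℚ.toℚᵘ (fromℤ y)     ≈⟨ ℚₚ.toℚᵘ-homo-* (fromℤ x) (fromℤ y) ⟨
  ℚ.toℚᵘ (fromℤ x ℚ.* fromℤ y)               ∎)
  where open ℚᵘₚ.≃-Reasoning

fromℤ-mono-≤ : ∀ {x y} → x ℤ.≤ y → fromℤ x ℚ.≤ fromℤ y
fromℤ-mono-≤ {x} {y} x≤y = ℚₚ.toℚᵘ-cancel-≤ (begin
  ℚ.toℚᵘ (fromℤ x)  ≃⟨ toℚᵘ-fromℤ x ⟩
  mkℚᵘ x 0          ≤⟨ ℚᵘ.*≤* (subst₂ ℤ._≤_ (sym (ℤₚ.*-identityʳ x)) (sym (ℤₚ.*-identityʳ y)) x≤y) ⟩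
  mkℚᵘ y 0          ≃⟨ toℚᵘ-fromℤ y ⟨
  ℚ.toℚᵘ (fromℤ y)  ∎)
  where open ℚᵘₚ.≤-Reasoning

∣fromℤ∣ : ∀ z → ℚ.∣ fromℤ z ∣ ≡ fromℤ (+ ℤ.∣ z ∣)
∣fromℤ∣ z = ℚₚ.toℚᵘ-injective (begin
  ℚ.toℚᵘ ℚ.∣ fromℤ z ∣       ≈⟨ ℚₚ.toℚᵘ-homo-∣-∣ (fromℤ z) ⟩
  ℚᵘ.∣ ℚ.toℚᵘ (fromℤ z) ∣    ≈⟨ ℚᵘₚ.∣-∣-cong (toℚᵘ-fromℤ z) ⟩
  mkℚᵘ (+ ℤ.∣ z ∣) 0         ≈⟨ toℚᵘ-fromℤ (+ ℤ.∣ z ∣) ⟨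
  ℚ.toℚᵘ (fromℤ (+ ℤ.∣ z ∣)) ∎)
  where open ℚᵘₚ.≃-Reasoning

/*-cancel : ∀ z n .{{_ : NonZero n}} → (z ℚ./ n) ℚ.* fromℤ (+ n) ≡ fromℤ z
/*-cancel z n@(suc n-1) = ℚₚ.toℚᵘ-injective (begin
  ℚ.toℚᵘ ((z ℚ./ n) ℚ.* fromℤ (+ n))              ≈⟨ ℚₚ.toℚᵘ-homo-* (z ℚ./ n) (fromℤ (+ n)) ⟩
  ℚ.toℚᵘ (z ℚ./ n) ℚᵘ.* ℚ.toℚᵘ (fromℤ (+ n))      ≈⟨ ℚᵘₚ.*-cong (ℚₚ.toℚᵘ-fromℚᵘ (mkℚᵘ z n-1)) (toℚᵘ-fromℤ (+ n)) ⟩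
  mkℚᵘ z n-1 ℚᵘ.* mkℚᵘ (+ n) 0                    ≈⟨ *≡* (trans (ℤₚ.*-identityʳ _) (cong (λ k → z ℤ.* + k) (sym (*-identityʳ n)))) ⟩
  mkℚᵘ z 0                                        ≈⟨ toℚᵘ-fromℤ z ⟨
  ℚ.toℚᵘ (fromℤ z)                                ∎)
  where open ℚᵘₚ.≃-Reasoning

fromℤ-*-cancelʳ : ∀ n .{{_ : NonZero n}} {x y} → x ℚ.* fromℤ (+ n) ≡ y ℚ.* fromℤ (+ n) → x ≡ y
fromℤ-*-cancelʳ n eq = ℚₚ.≤-antisym
  (ℚₚ.*-cancelʳ-≤-pos (fromℤ (+ n)) (ℚₚ.≤-reflexive eq))
  (ℚₚ.*-cancelʳ-≤-pos (fromℤ (+ n)) (ℚₚ.≤-reflexive (sym eq)))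
  where instance _ = ℚₚ.normalize-pos n 1

-- Integer square roots

-- These two bounds characterise ⌊√n⌋, so exactness on perfect squares follows by uniqueness.
√-bounds : ∀ n → √ n * √ n ≤ n × n < suc (√ n) * suc (√ n)
√-bounds zero = z≤n , s≤s z≤n
√-bounds (suc n) with suc (√ n) * suc (√ n) ≤? suc n | √-bounds n
-- `hi` puts `suc n` below or at the square of `suc (√ n)`, and the next square is strictly larger.
... | yes s²≤n | lo , hi = s²≤n , ≤-<-trans hi (*-mono-< {suc (√ n)} (n<1+n _) (n<1+n _))
... | no  s²≰n | lo , hi = m≤n⇒m≤1+n lo , ≰⇒> s²≰n

√[n*n]≡n : ∀ n → √ (n * n) ≡ n
√[n*n]≡n n with √-bounds (n * n)
... | lo , hi = ≤-antisym (≮⇒≥ λ n<√ → <⇒≱ (*-mono-< n<√ n<√) lo)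
                          (≮⇒≥ λ √<n → <⇒≱ hi (*-mono-≤ √<n √<n))

^½-even : ∀ q n → q ^½ (2 * n) ≡ q ^ n
^½-even q n = trans (cong √_ eq) (√[n*n]≡n (q ^ n))
  where
  eq : q ^ (2 * n) ≡ q ^ n * q ^ n
  eq = trans (cong (λ k → q ^ (n + k)) (+-identityʳ n)) (^-distribˡ-+-* q n n)

^½-square : ∀ r n → (r ^ 2) ^½ n ≡ r ^ n
^½-square r n = trans (cong √_ (trans (^-*-assoc r 2 n) refl)) (^½-even r n)

-- Coefficients of ∏ₓ (t + x)

module Coefficients {A : Set} (_⊕_ _⊗_ : A → A → A) (0# 1# : A) where

  -- Indexed by the power of t: for h at most the length n, this is the elementary symmetric
  -- polynomial of degree n - h. The operations are parameters so that one recursion serves ℤ, where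
  -- signs occur, and ℕ, where estimates are monotone.
  coeff : List A → ℕ → A
  coeff []       zero    = 1#
  coeff []       (suc h) = 0#
  coeff (x ∷ xs) zero    = x ⊗ coeff xs zero
  coeff (x ∷ xs) (suc h) = coeff xs h ⊕ (x ⊗ coeff xs (suc h))

open Coefficients _+_ _*_ 0 1 using (coeff)
open Coefficients ℤ._+_ ℤ._*_ 0ℤ 1ℤ renaming (coeff to coeffℤ)

coeffℤ-map-+ : ∀ xs h → coeffℤ (map +_ xs) h ≡ + coeff xs h
coeffℤ-map-+ []       zero    = refl
coeffℤ-map-+ []       (suc h) = refl
coeffℤ-map-+ (x ∷ xs) zero    = trans (cong (+ x ℤ.*_) (coeffℤ-map-+ xs 0)) (sym (ℤₚ.pos-* x _))
coeffℤ-map-+ (x ∷ xs) (suc h) = cong₂ ℤ._+_ (coeffℤ-map-+ xs h)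
  (trans (cong (+ x ℤ.*_) (coeffℤ-map-+ xs (suc h))) (sym (ℤₚ.pos-* x _)))

-- A product of monic linear factors is monic, with degree the number of factors.
coeff-length : ∀ xs → coeff xs (length xs) ≡ 1
coeff->length : ∀ xs {h} → length xs < h → coeff xs h ≡ 0

coeff-length []       = refl
coeff-length (x ∷ xs) rewrite coeff-length xs | coeff->length xs (n<1+n _) = cong suc (*-zeroʳ x)

coeff->length []       (s≤s _)   = refl
coeff->length (x ∷ xs) (s≤s n<h)
  rewrite coeff->length xs n<h | coeff->length xs (m<n⇒m<1+n n<h) = *-zeroʳ x

coeffℤ->length : ∀ xs {h} → length xs < h → coeffℤ xs h ≡ 0ℤ
coeffℤ->length []       (s≤s _)   = refl
coeffℤ->length (x ∷ xs) (s≤s n<h)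
  rewrite coeffℤ->length xs n<h | coeffℤ->length xs (m<n⇒m<1+n n<h)
  = trans (ℤₚ.+-identityˡ _) (ℤₚ.*-zeroʳ x)

-- Substituting -t for t turns ∏(t - x) into (-1)^n ∏(t + x). Keeping a sign on both sides avoids
-- the exponent n - h.
coeffℤ-neg : ∀ xs h → -1ℤ ℤ.^ h ℤ.* coeffℤ (map -_ xs) h ≡ -1ℤ ℤ.^ length xs ℤ.* coeffℤ xs h
coeffℤ-neg []       zero    = refl
coeffℤ-neg []       (suc h) = ℤₚ.*-zeroʳ (-1ℤ ℤ.^ suc h)
coeffℤ-neg (x ∷ xs) zero    = begin
  1ℤ ℤ.* (- x ℤ.* Y)        ≡⟨ lem₁ x Y ⟩
  - x ℤ.* (1ℤ ℤ.* Y)        ≡⟨ cong (- x ℤ.*_) (coeffℤ-neg xs zero) ⟩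
  - x ℤ.* (S ℤ.* X)         ≡⟨ lem₂ x S X ⟩
  (-1ℤ ℤ.* S) ℤ.* (x ℤ.* X) ∎
  where
  open ≡-Reasoning
  X = coeffℤ xs 0
  Y = coeffℤ (map -_ xs) 0
  S = -1ℤ ℤ.^ length xs
  lem₁ : ∀ x y → 1ℤ ℤ.* (- x ℤ.* y) ≡ - x ℤ.* (1ℤ ℤ.* y)
  lem₁ = ℤ-Solver.solve-∀
  lem₂ : ∀ x s y → - x ℤ.* (s ℤ.* y) ≡ (-1ℤ ℤ.* s) ℤ.* (x ℤ.* y)
  lem₂ = ℤ-Solver.solve-∀
coeffℤ-neg (x ∷ xs) (suc h) = begin
  (-1ℤ ℤ.* H) ℤ.* (Y ℤ.+ - x ℤ.* Y′)                       ≡⟨ lem₁ x H Y Y′ ⟩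
  - (H ℤ.* Y) ℤ.+ - x ℤ.* ((-1ℤ ℤ.* H) ℤ.* Y′)             ≡⟨ cong₂ (λ a b → - a ℤ.+ - x ℤ.* b) (coeffℤ-neg xs h) (coeffℤ-neg xs (suc h)) ⟩
  - (S ℤ.* X) ℤ.+ - x ℤ.* (S ℤ.* X′)                       ≡⟨ lem₂ x S X X′ ⟩
  (-1ℤ ℤ.* S) ℤ.* (X ℤ.+ x ℤ.* X′)                         ∎
  where
  open ≡-Reasoning
  X = coeffℤ xs h
  X′ = coeffℤ xs (suc h)
  Y = coeffℤ (map -_ xs) h
  Y′ = coeffℤ (map -_ xs) (suc h)
  H = -1ℤ ℤ.^ h
  S = -1ℤ ℤ.^ length xs
  lem₁ : ∀ x h y y′ → (-1ℤ ℤ.* h) ℤ.* (y ℤ.+ - x ℤ.* y′) ≡ - (h ℤ.* y) ℤ.+ - x ℤ.* ((-1ℤ ℤ.* h) ℤ.* y′)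
  lem₁ = ℤ-Solver.solve-∀
  lem₂ : ∀ x s y y′ → - (s ℤ.* y) ℤ.+ - x ℤ.* (s ℤ.* y′) ≡ (-1ℤ ℤ.* s) ℤ.* (y ℤ.+ x ℤ.* y′)
  lem₂ = ℤ-Solver.solve-∀

-- Elementary symmetric polynomials have nonnegative coefficients, so the triangle inequality bounds
-- them by their values at upper bounds of the absolute values.
∣coeffℤ∣≤coeff : ∀ {xs ys} → Pointwise (λ x y → ℤ.∣ x ∣ ≤ y) xs ys → ∀ h → ℤ.∣ coeffℤ xs h ∣ ≤ coeff ys h
∣coeffℤ∣≤coeff []                        zero    = ≤-refl
∣coeffℤ∣≤coeff []                        (suc h) = ≤-refl
∣coeffℤ∣≤coeff {x ∷ xs} {y ∷ ys} (r ∷ rs) zero    = begin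
  ℤ.∣ x ℤ.* coeffℤ xs 0 ∣     ≡⟨ ℤₚ.abs-* x _ ⟩
  ℤ.∣ x ∣ * ℤ.∣ coeffℤ xs 0 ∣ ≤⟨ *-mono-≤ r (∣coeffℤ∣≤coeff rs 0) ⟩
  y * coeff ys 0              ∎
  where open ≤-Reasoning
∣coeffℤ∣≤coeff {x ∷ xs} {y ∷ ys} (r ∷ rs) (suc h) = begin
  ℤ.∣ coeffℤ xs h ℤ.+ x ℤ.* coeffℤ xs (suc h) ∣           ≤⟨ ℤₚ.∣i+j∣≤∣i∣+∣j∣ (coeffℤ xs h) _ ⟩
  ℤ.∣ coeffℤ xs h ∣ + ℤ.∣ x ℤ.* coeffℤ xs (suc h) ∣       ≡⟨ cong (λ z → ℤ.∣ coeffℤ xs h ∣ + z) (ℤₚ.abs-* x _) ⟩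
  ℤ.∣ coeffℤ xs h ∣ + ℤ.∣ x ∣ * ℤ.∣ coeffℤ xs (suc h) ∣   ≤⟨ +-mono-≤ (∣coeffℤ∣≤coeff rs h) (*-mono-≤ r (∣coeffℤ∣≤coeff rs (suc h))) ⟩
  coeff ys h + y * coeff ys (suc h)                       ∎
  where open ≤-Reasoning

-- The coefficient at t^h is homogeneous of degree n - h in the n elements, so doubling every
-- element gains 2^(n-h). The factor 2^h stands on the right to avoid the subtraction.
coeff-halving : ∀ {xs ys} → Pointwise (λ x y → 2 * x ≤ y) xs ys →
  ∀ h → 2 ^ length ys * coeff xs h ≤ 2 ^ h * coeff ys h
coeff-halving []                         zero    = ≤-refl
coeff-halving []                         (suc h) = z≤n
coeff-halving {x ∷ xs} {y ∷ ys} (r ∷ rs) zero    = begin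
  2 * N * (x * X)   ≡⟨ lem N x X ⟩
  2 * x * (N * X)   ≤⟨ *-mono-≤ r (coeff-halving rs 0) ⟩
  y * (1 * Y)       ≡⟨ cong (y *_) (*-identityˡ Y) ⟩
  y * Y             ≡⟨ *-identityˡ (y * Y) ⟨
  1 * (y * Y)       ∎
  where
  open ≤-Reasoning
  N = 2 ^ length ys
  X = coeff xs 0
  Y = coeff ys 0
  lem : ∀ n x z → 2 * n * (x * z) ≡ 2 * x * (n * z)
  lem = solve-∀
coeff-halving {x ∷ xs} {y ∷ ys} (r ∷ rs) (suc h) = begin
  2 * N * (X + x * X′)                ≡⟨ lem₁ N x X X′ ⟩
  2 * (N * X) + 2 * x * (N * X′)      ≤⟨ +-mono-≤ (*-monoʳ-≤ 2 (coeff-halving rs h)) (*-mono-≤ r (coeff-halving rs (suc h))) ⟩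
  2 * (H * Y) + y * (2 * H * Y′)      ≡⟨ lem₂ H y Y Y′ ⟩
  2 * H * (Y + y * Y′)                ∎
  where
  open ≤-Reasoning
  N = 2 ^ length ys
  H = 2 ^ h
  X = coeff xs h
  X′ = coeff xs (suc h)
  Y = coeff ys h
  Y′ = coeff ys (suc h)
  lem₁ : ∀ n x z z′ → 2 * n * (z + x * z′) ≡ 2 * (n * z) + 2 * x * (n * z′)
  lem₁ = solve-∀
  lem₂ : ∀ h y z z′ → 2 * (h * z) + y * (2 * h * z′) ≡ 2 * h * (z + y * z′)
  lem₂ = solve-∀

-- Finite sums

sumℚ : (ℕ → ℚ) → ℕ → ℚ
sumℚ f n = foldr ℚ._+_ 0ℚ (applyUpTo f n)

sumℤ : (ℕ → ℤ) → ℕ → ℤ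
sumℤ f n = foldr ℤ._+_ 0ℤ (applyUpTo f n)

sumℚ-fromℤ : ∀ {f g} n → (∀ k → k < n → f k ≡ fromℤ (g k)) → sumℚ f n ≡ fromℤ (sumℤ g n)
sumℚ-fromℤ         zero    f≗g = refl
sumℚ-fromℤ {g = g} (suc n) f≗g = trans
  (cong₂ ℚ._+_ (f≗g 0 z<s) (sumℚ-fromℤ n (λ k k<n → f≗g (suc k) (s<s k<n))))
  (sym (fromℤ-+ (g 0) _))

sumℤ-zero : ∀ {f} n → (∀ k → k < n → f k ≡ 0ℤ) → sumℤ f n ≡ 0ℤ
sumℤ-zero zero    f≗0 = refl
sumℤ-zero (suc n) f≗0 = cong₂ ℤ._+_ (f≗0 0 z<s) (sumℤ-zero n (λ k k<n → f≗0 (suc k) (s<s k<n)))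

sumℤ-split : ∀ f m n → sumℤ f (m + n) ≡ sumℤ f m ℤ.+ sumℤ (λ k → f (m + k)) n
sumℤ-split f zero    n = sym (ℤₚ.+-identityˡ _)
sumℤ-split f (suc m) n = trans (cong (λ z → f 0 ℤ.+ z) (sumℤ-split (λ k → f (suc k)) m n)) (sym (ℤₚ.+-assoc (f 0) _ _))

sumℤ-linear : ∀ x f g n → sumℤ (λ k → f k ℤ.+ x ℤ.* g k) n ≡ sumℤ f n ℤ.+ x ℤ.* sumℤ g n
sumℤ-linear x f g zero    = sym (trans (ℤₚ.+-identityˡ _) (ℤₚ.*-zeroʳ x))
sumℤ-linear x f g (suc n) = trans
  (cong (λ z → f 0 ℤ.+ x ℤ.* g 0 ℤ.+ z) (sumℤ-linear x (λ k → f (suc k)) (λ k → g (suc k)) n))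
  (lem x (f 0) (g 0) _ _)
  where
  lem : ∀ x a b s t → a ℤ.+ x ℤ.* b ℤ.+ (s ℤ.+ x ℤ.* t) ≡ a ℤ.+ s ℤ.+ x ℤ.* (b ℤ.+ t)
  lem = ℤ-Solver.solve-∀

sumℤ-cong : ∀ {f g} n → (∀ k → f k ≡ g k) → sumℤ f n ≡ sumℤ g n
sumℤ-cong zero    f≗g = refl
sumℤ-cong (suc n) f≗g = cong₂ ℤ._+_ (f≗g 0) (sumℤ-cong n (λ k → f≗g (suc k)))

-- Used to cut a full Cauchy product down to the summation range in the definition of C_j(i); the
-- window is half-open, excluding `hi`.
sumℤ-window : ∀ f lo hi n → lo ≤ hi → hi ≤ n →
  (∀ k → k < lo → f k ≡ 0ℤ) → (∀ k → hi ≤ k → k < n → f k ≡ 0ℤ) →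
  sumℤ f n ≡ sumℤ (λ k → f (lo + k)) (hi ∸ lo)
sumℤ-window f lo hi n lo≤hi hi≤n below above = begin
  sumℤ f n                                              ≡⟨ cong (sumℤ f) (m+[n∸m]≡n hi≤n) ⟨
  sumℤ f (hi + (n ∸ hi))                                ≡⟨ sumℤ-split f hi (n ∸ hi) ⟩
  sumℤ f hi ℤ.+ sumℤ (λ k → f (hi + k)) (n ∸ hi)        ≡⟨ cong (λ z → sumℤ f hi ℤ.+ z) (sumℤ-zero (n ∸ hi) λ k k< →
                                                             above (hi + k) (m≤m+n hi k) (subst (hi + k <_) (m+[n∸m]≡n hi≤n) (+-monoʳ-< hi k<))) ⟩
  sumℤ f hi ℤ.+ 0ℤ                                      ≡⟨ ℤₚ.+-identityʳ _ ⟩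
  sumℤ f hi                                             ≡⟨ cong (sumℤ f) (m+[n∸m]≡n lo≤hi) ⟨
  sumℤ f (lo + (hi ∸ lo))                               ≡⟨ sumℤ-split f lo (hi ∸ lo) ⟩
  sumℤ f lo ℤ.+ sumℤ (λ k → f (lo + k)) (hi ∸ lo)       ≡⟨ cong (ℤ._+ sumℤ (λ k → f (lo + k)) (hi ∸ lo)) (sumℤ-zero lo below) ⟩
  0ℤ ℤ.+ sumℤ (λ k → f (lo + k)) (hi ∸ lo)              ≡⟨ ℤₚ.+-identityˡ _ ⟩
  sumℤ (λ k → f (lo + k)) (hi ∸ lo)                     ∎
  where open ≡-Reasoning

-- Concatenating lists of factors multiplies the polynomials, so this is the Cauchy product.
coeffℤ-++ : ∀ xs ys n → coeffℤ (xs ++ ys) n ≡ sumℤ (λ h → coeffℤ xs h ℤ.* coeffℤ ys (n ∸ h)) (suc n)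
coeffℤ-++ [] ys n = begin
  coeffℤ ys n                   ≡⟨ lem (coeffℤ ys n) ⟨
  1ℤ ℤ.* coeffℤ ys n ℤ.+ 0ℤ     ≡⟨ cong (λ z → 1ℤ ℤ.* coeffℤ ys n ℤ.+ z) (sumℤ-zero n (λ k _ → ℤₚ.*-zeroˡ (coeffℤ ys (n ∸ suc k)))) ⟨
  _                             ∎
  where
  open ≡-Reasoning
  lem : ∀ x → 1ℤ ℤ.* x ℤ.+ 0ℤ ≡ x
  lem = ℤ-Solver.solve-∀
coeffℤ-++ (x ∷ xs) ys zero = trans (cong (x ℤ.*_) (coeffℤ-++ xs ys zero)) (lem x (coeffℤ xs 0) (coeffℤ ys 0))
  where
  lem : ∀ x a b → x ℤ.* (a ℤ.* b ℤ.+ 0ℤ) ≡ x ℤ.* a ℤ.* b ℤ.+ 0ℤ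
  lem = ℤ-Solver.solve-∀
coeffℤ-++ (x ∷ xs) ys (suc n) = begin
  coeffℤ (xs ++ ys) n ℤ.+ x ℤ.* coeffℤ (xs ++ ys) (suc n)    ≡⟨ cong₂ (λ a b → a ℤ.+ x ℤ.* b) (coeffℤ-++ xs ys n) (coeffℤ-++ xs ys (suc n)) ⟩
  sumℤ F (suc n) ℤ.+ x ℤ.* (a ℤ.* b ℤ.+ sumℤ G (suc n))      ≡⟨ lem₁ x (sumℤ F (suc n)) a b (sumℤ G (suc n)) ⟩
  x ℤ.* a ℤ.* b ℤ.+ (sumℤ F (suc n) ℤ.+ x ℤ.* sumℤ G (suc n)) ≡⟨ cong (λ z → x ℤ.* a ℤ.* b ℤ.+ z) (sumℤ-linear x F G (suc n)) ⟨
  x ℤ.* a ℤ.* b ℤ.+ sumℤ (λ h → F h ℤ.+ x ℤ.* G h) (suc n)   ≡⟨ cong (λ z → x ℤ.* a ℤ.* b ℤ.+ z) (sumℤ-cong (suc n) λ h →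
                                                                  lem₂ x (coeffℤ xs h) (coeffℤ xs (suc h)) (coeffℤ ys (n ∸ h))) ⟩
  x ℤ.* a ℤ.* b ℤ.+ sumℤ (λ h → coeffℤ (x ∷ xs) (suc h) ℤ.* coeffℤ ys (n ∸ h)) (suc n) ∎
  where
  open ≡-Reasoning
  a = coeffℤ xs 0
  b = coeffℤ ys (suc n)
  F G : ℕ → ℤ
  F h = coeffℤ xs h ℤ.* coeffℤ ys (n ∸ h)
  G h = coeffℤ xs (suc h) ℤ.* coeffℤ ys (n ∸ h)
  lem₁ : ∀ x f a b g → f ℤ.+ x ℤ.* (a ℤ.* b ℤ.+ g) ≡ x ℤ.* a ℤ.* b ℤ.+ (f ℤ.+ x ℤ.* g)
  lem₁ = ℤ-Solver.solve-∀
  lem₂ : ∀ x a b c → a ℤ.* c ℤ.+ x ℤ.* (b ℤ.* c) ≡ (a ℤ.+ x ℤ.* b) ℤ.* c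
  lem₂ = ℤ-Solver.solve-∀

^-distribʳ-* : ∀ n m o → (m * o) ^ n ≡ m ^ n * o ^ n
^-distribʳ-* zero    m o = refl
^-distribʳ-* (suc n) m o = trans (cong (m * o *_) (^-distribʳ-* n m o)) ([m*n]*[o*p]≡[m*o]*[n*p] m o (m ^ n) (o ^ n))

-- Geometric progressions and Gaussian coefficients

geometric : (r c n : ℕ) → List ℕ
geometric r c zero    = []
geometric r c (suc n) = c ∷ geometric r (c * r) n

length-geometric : ∀ r c n → length (geometric r c n) ≡ n
length-geometric r c zero    = refl
length-geometric r c (suc n) = cong suc (length-geometric r (c * r) n)

geometric-++ : ∀ r c m n → geometric r c (m + n) ≡ geometric r c m ++ geometric r (c * r ^ m) n
geometric-++ r c zero    n = cong (λ k → geometric r k n) (sym (*-identityʳ c))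
geometric-++ r c (suc m) n = cong (c ∷_) (trans (geometric-++ r (c * r) m n)
  (cong (λ k → geometric r (c * r) m ++ geometric r k n) (*-assoc c r (r ^ m))))

module _ (q : ℕ) .{{q>1 : NonTrivial q}} where

  instance
    q≢0 : NonZero q
    q≢0 = nonTrivial⇒nonZero q

  [q^_∸1] : ℕ → ℕ
  [q^ n ∸1] = q ^ n ∸ 1

  -- This is (q-1)^n times the usual q-factorial; the powers of q-1 cancel in Gaussian coefficients.
  qFactorial : ℕ → ℕ
  qFactorial zero    = 1
  qFactorial (suc n) = [q^ suc n ∸1] * qFactorial n

  qFactorial-nonZero : ∀ n → NonZero (qFactorial n)
  qFactorial-nonZero zero    = _
  qFactorial-nonZero (suc n) = m*n≢0 [q^ suc n ∸1] _ {{q^n∸1-nonZero q {suc n} (s≤s z≤n)}} {{qFactorial-nonZero n}}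

  q^n≡1+[q^n-1] : ∀ n → q ^ n ≡ 1 + [q^ n ∸1]
  q^n≡1+[q^n-1] n = sym (m+[n∸m]≡n (m^n>0 q n))

  q^[m+n]-1 : ∀ m n → [q^ m + n ∸1] ≡ q ^ m * [q^ n ∸1] + [q^ m ∸1]
  q^[m+n]-1 m n = suc-injective (begin
    1 + [q^ m + n ∸1]                       ≡⟨ q^n≡1+[q^n-1] (m + n) ⟨
    q ^ (m + n)                           ≡⟨ ^-distribˡ-+-* q m n ⟩
    q ^ m * q ^ n                         ≡⟨ cong (q ^ m *_) (q^n≡1+[q^n-1] n) ⟩
    q ^ m * (1 + [q^ n ∸1])                 ≡⟨ *-suc (q ^ m) ([q^ n ∸1]) ⟩
    q ^ m + q ^ m * [q^ n ∸1]               ≡⟨ cong (λ z → z + q ^ m * [q^ n ∸1]) (q^n≡1+[q^n-1] m) ⟩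
    1 + ([q^ m ∸1] + q ^ m * [q^ n ∸1])       ≡⟨ cong suc (+-comm ([q^ m ∸1]) _) ⟩
    1 + (q ^ m * [q^ n ∸1] + [q^ m ∸1])       ∎)
    where open ≡-Reasoning

  [1+m]C2 : ∀ m → suc m choose 2 ≡ m + m choose 2
  [1+m]C2 m = trans (sym (nCk+nC[k+1]≡[n+1]C[k+1] m 1)) (cong (λ z → z + m choose 2) (nC1≡n m))

  q^[1+m]C2 : ∀ m → q ^ (suc m choose 2) ≡ q ^ m * q ^ (m choose 2)
  q^[1+m]C2 m = trans (cong (q ^_) ([1+m]C2 m)) (^-distribˡ-+-* q m (m choose 2))

  -- The q-binomial theorem with denominators cleared, so that it lives in ℕ. Splitting off the
  -- factor t + c leaves a progression starting at cq, and the induction step is a q-Pascal rule.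
  coeff-geometric : ∀ c h m →
    coeff (geometric q c (h + m)) h * (qFactorial h * qFactorial m) ≡ c ^ m * q ^ (m choose 2) * qFactorial (h + m)
  coeff-geometric c zero zero = refl
  coeff-geometric c zero (suc m) = begin
    c * X * (1 * (B * F))                        ≡⟨ lem₁ c X B F ⟩
    c * B * (X * (1 * F))                        ≡⟨ cong (c * B *_) (coeff-geometric (c * q) zero m) ⟩
    c * B * ((c * q) ^ m * Cm * F)               ≡⟨ cong (λ z → c * B * (z * Cm * F)) (^-distribʳ-* m c q) ⟩
    c * B * (c ^ m * q ^ m * Cm * F)             ≡⟨ lem₂ c B (c ^ m) (q ^ m) Cm F ⟩
    c * c ^ m * (q ^ m * Cm) * (B * F)           ≡⟨ cong (λ z → c * c ^ m * z * (B * F)) (q^[1+m]C2 m) ⟨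
    c * c ^ m * q ^ (suc m choose 2) * (B * F)        ∎
    where
    open ≡-Reasoning
    X = coeff (geometric q (c * q) m) 0
    B = [q^ suc m ∸1]
    F = qFactorial m
    Cm = q ^ (m choose 2)
    lem₁ : ∀ c x b f → c * x * (1 * (b * f)) ≡ c * b * (x * (1 * f))
    lem₁ = solve-∀
    lem₂ : ∀ c b cm qm d f → c * b * (cm * qm * d * f) ≡ c * cm * (qm * d) * (b * f)
    lem₂ = solve-∀
  coeff-geometric c (suc h) zero = begin
    (X + c * Y) * (A * F * 1)            ≡⟨ cong (λ z → (X + c * z) * (A * F * 1)) Y≡0 ⟩
    (X + c * 0) * (A * F * 1)            ≡⟨ lem₁ X c A F ⟩
    A * (X * (F * 1))                    ≡⟨ cong (A *_) (coeff-geometric (c * q) h zero) ⟩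
    A * (1 * 1 * qFactorial (h + 0))     ≡⟨ lem₂ A (qFactorial (h + 0)) ⟩
    1 * 1 * (A * qFactorial (h + 0))     ≡⟨ cong (λ z → 1 * 1 * ([q^ suc z ∸1] * qFactorial (h + 0))) (+-identityʳ h) ⟨
    _                                    ∎
    where
    open ≡-Reasoning
    X = coeff (geometric q (c * q) (h + 0)) h
    Y = coeff (geometric q (c * q) (h + 0)) (suc h)
    A = [q^ suc h ∸1]
    F = qFactorial h
    Y≡0 : Y ≡ 0
    Y≡0 = coeff->length (geometric q (c * q) (h + 0))
      (s≤s (≤-reflexive (trans (length-geometric q (c * q) (h + 0)) (+-identityʳ h))))
    lem₁ : ∀ x c a f → (x + c * 0) * (a * f * 1) ≡ a * (x * (f * 1))
    lem₁ = solve-∀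
    lem₂ : ∀ a f → a * (1 * 1 * f) ≡ 1 * 1 * (a * f)
    lem₂ = solve-∀
  coeff-geometric c (suc h) (suc m) = begin
    (X + c * Y) * (A * F * (B * G))                                  ≡⟨ lem₁ X c Y A F B G ⟩
    A * (X * (F * (B * G))) + c * B * (Y * (A * F * G))              ≡⟨ cong₂ (λ x y → A * x + c * B * y) (coeff-geometric (c * q) h (suc m)) IH ⟩
    A * ((c * q) ^ suc m * q ^ (suc m choose 2) * Φ) + c * B * ((c * q) ^ m * Cm * Φ)
                                                                     ≡⟨ cong₂ (λ x y → A * (c * q * x * y * Φ) + c * B * (x * Cm * Φ)) (^-distribʳ-* m c q) (q^[1+m]C2 m) ⟩
    A * (c * q * (c ^ m * q ^ m) * (q ^ m * Cm) * Φ) + c * B * (c ^ m * q ^ m * Cm * Φ)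
                                                                     ≡⟨ lem₂ A c q (c ^ m) (q ^ m) Cm Φ B ⟩
    c * c ^ m * (q ^ m * Cm) * ((q * q ^ m * A + B) * Φ)             ≡⟨ cong₂ (λ x y → c * c ^ m * x * (y * Φ)) (q^[1+m]C2 m) p ⟨
    c * c ^ m * q ^ (suc m choose 2) * ([q^ suc (h + suc m) ∸1] * Φ)        ∎
    where
    open ≡-Reasoning
    X = coeff (geometric q (c * q) (h + suc m)) h
    Y = coeff (geometric q (c * q) (h + suc m)) (suc h)
    A = [q^ suc h ∸1]
    B = [q^ suc m ∸1]
    F = qFactorial h
    G = qFactorial m
    Φ = qFactorial (h + suc m)
    Cm = q ^ (m choose 2)
    -- The tail has length h + (m + 1) = (h + 1) + m, and the second reading makes the hypothesis
    -- with smaller m applicable.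
    IH : Y * (A * F * G) ≡ (c * q) ^ m * Cm * Φ
    IH = subst (λ n → coeff (geometric q (c * q) n) (suc h) * (A * F * G) ≡ (c * q) ^ m * Cm * qFactorial n)
      (sym (+-suc h m)) (coeff-geometric (c * q) (suc h) m)
    -- This splitting of the top factor is what combines the two summands of the q-Pascal rule.
    p : [q^ suc (h + suc m) ∸1] ≡ q * q ^ m * A + B
    p = trans (cong [q^_∸1] (+-comm (suc h) (suc m))) (q^[m+n]-1 (suc m) (suc h))
    lem₁ : ∀ x c y a f b g → (x + c * y) * (a * f * (b * g)) ≡ a * (x * (f * (b * g))) + c * b * (y * (a * f * g))
    lem₁ = solve-∀
    lem₂ : ∀ a c q cm qm d φ b → a * (c * q * (cm * qm) * (qm * d) * φ) + c * b * (cm * qm * d * φ)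
      ≡ c * cm * (qm * d) * ((q * qm * a + b) * φ)
    lem₂ = solve-∀

  -- The first factor of the defining product is the quotient of the leading factors of two
  -- q-factorials; the remaining factors form the coefficient with both indices lowered by one.
  gaussian-qFactorial : ∀ h m →
    gaussian q (h + m) h ℚ.* fromℤ (+ (qFactorial h * qFactorial m)) ≡ fromℤ (+ qFactorial (h + m))
  gaussian-qFactorial zero m = trans (ℚₚ.*-identityˡ _) (cong (λ z → fromℤ (+ z)) (*-identityˡ (qFactorial m)))
  gaussian-qFactorial (suc h) m = begin
    N/A ℚ.* Γ ℚ.* fromℤ (+ (A * F * G))                         ≡⟨ cong (λ z → N/A ℚ.* Γ ℚ.* fromℤ (+ z)) (*-assoc A F G) ⟩
    N/A ℚ.* Γ ℚ.* fromℤ (+ (A * (F * G)))                       ≡⟨ cong (λ z → N/A ℚ.* Γ ℚ.* fromℤ z) (ℤₚ.pos-* A (F * G)) ⟩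
    N/A ℚ.* Γ ℚ.* fromℤ (+ A ℤ.* + (F * G))                     ≡⟨ cong (N/A ℚ.* Γ ℚ.*_) (fromℤ-* (+ A) (+ (F * G))) ⟩
    N/A ℚ.* Γ ℚ.* (fromℤ (+ A) ℚ.* fromℤ (+ (F * G)))           ≡⟨ solve 4 (λ a b c d → a :* b :* (c :* d) := (a :* c) :* (b :* d)) refl N/A Γ (fromℤ (+ A)) (fromℤ (+ (F * G))) ⟩
    (N/A ℚ.* fromℤ (+ A)) ℚ.* (Γ ℚ.* fromℤ (+ (F * G)))         ≡⟨ cong₂ ℚ._*_ (/*-cancel (+ N) A) (gaussian-qFactorial h m) ⟩
    fromℤ (+ N) ℚ.* fromℤ (+ qFactorial (h + m))                ≡⟨ fromℤ-* (+ N) (+ qFactorial (h + m)) ⟨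
    fromℤ (+ N ℤ.* + qFactorial (h + m))                        ≡⟨ cong fromℤ (ℤₚ.pos-* N (qFactorial (h + m))) ⟨
    fromℤ (+ (N * qFactorial (h + m)))                          ∎
    where
    open ≡-Reasoning
    open +-*-Solver
    A = [q^ suc h ∸1]
    F = qFactorial h
    G = qFactorial m
    N = [q^ suc (h + m) ∸1]
    Γ = gaussian q (h + m) h
    instance _ = q^n∸1-nonZero q {suc h} (s≤s z≤n)
    N/A = + N ℚ./ A

  -- The q-binomial theorem for the rational Gaussian coefficient: the sides agree after
  -- multiplication by the nonzero number `FG`.
  gaussian-coeff : ∀ c h m →
    fromℤ (+ (c ^ m * q ^ (m choose 2))) ℚ.* gaussian q (h + m) h ≡ fromℤ (+ coeff (geometric q c (h + m)) h)
  gaussian-coeff c h m = fromℤ-*-cancelʳ FG (begin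
    fromℤ (+ W) ℚ.* Γ ℚ.* fromℤ (+ FG)         ≡⟨ ℚₚ.*-assoc (fromℤ (+ W)) Γ _ ⟩
    fromℤ (+ W) ℚ.* (Γ ℚ.* fromℤ (+ FG))       ≡⟨ cong (fromℤ (+ W) ℚ.*_) (gaussian-qFactorial h m) ⟩
    fromℤ (+ W) ℚ.* fromℤ (+ Φ)                ≡⟨ fromℤ-* (+ W) (+ Φ) ⟨
    fromℤ (+ W ℤ.* + Φ)                        ≡⟨ cong fromℤ (ℤₚ.pos-* W Φ) ⟨
    fromℤ (+ (W * Φ))                          ≡⟨ cong (λ z → fromℤ (+ z)) (coeff-geometric c h m) ⟨
    fromℤ (+ (E * FG))                         ≡⟨ cong fromℤ (ℤₚ.pos-* E FG) ⟩
    fromℤ (+ E ℤ.* + FG)                       ≡⟨ fromℤ-* (+ E) (+ FG) ⟩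
    fromℤ (+ E) ℚ.* fromℤ (+ FG)               ∎)
    where
    open ≡-Reasoning
    W = c ^ m * q ^ (m choose 2)
    FG = qFactorial h * qFactorial m
    Φ = qFactorial (h + m)
    E = coeff (geometric q c (h + m)) h
    Γ = gaussian q (h + m) h
    instance _ = m*n≢0 (qFactorial h) (qFactorial m) {{qFactorial-nonZero h}} {{qFactorial-nonZero m}}

-- Signs of the coefficients

∣-1^n*z∣≡∣z∣ : ∀ n z → ℤ.∣ -1ℤ ℤ.^ n ℤ.* z ∣ ≡ ℤ.∣ z ∣
∣-1^n*z∣≡∣z∣ zero    z = cong ℤ.∣_∣ (ℤₚ.*-identityˡ z)
∣-1^n*z∣≡∣z∣ (suc n) z = begin
  ℤ.∣ -1ℤ ℤ.* -1ℤ ℤ.^ n ℤ.* z ∣    ≡⟨ cong ℤ.∣_∣ (lem (-1ℤ ℤ.^ n) z) ⟩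
  ℤ.∣ - (-1ℤ ℤ.^ n ℤ.* z) ∣        ≡⟨ ℤₚ.∣-i∣≡∣i∣ (-1ℤ ℤ.^ n ℤ.* z) ⟩
  ℤ.∣ -1ℤ ℤ.^ n ℤ.* z ∣            ≡⟨ ∣-1^n*z∣≡∣z∣ n z ⟩
  ℤ.∣ z ∣                          ∎
  where
  open ≡-Reasoning
  lem : ∀ p z → -1ℤ ℤ.* p ℤ.* z ≡ - (p ℤ.* z)
  lem = ℤ-Solver.solve-∀

-1^n*-cancelˡ : ∀ n {x y} → -1ℤ ℤ.^ n ℤ.* x ≡ -1ℤ ℤ.^ n ℤ.* y → x ≡ y
-1^n*-cancelˡ n {x} {y} = ℤₚ.*-cancelˡ-≡ (-1ℤ ℤ.^ n) x y {{nz}}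
  where
  nz : ℤ.NonZero (-1ℤ ℤ.^ n)
  nz = ℤ.≢-nonZero { -1ℤ ℤ.^ n } λ eq → 1+n≢0 {0} (trans (sym (∣-1^n*z∣≡∣z∣ n 1ℤ)) (cong (λ z → ℤ.∣ z ℤ.* 1ℤ ∣) eq))

-- With h + m elements the coefficient at t^h is homogeneous of degree m, whence the sign (-1)^m.
coeffℤ-map-neg : ∀ xs h m → length xs ≡ h + m →
  coeffℤ (map -_ (map +_ xs)) h ≡ -1ℤ ℤ.^ m ℤ.* + coeff xs h
coeffℤ-map-neg xs h m len = -1^n*-cancelˡ h (begin
  -1ℤ ℤ.^ h ℤ.* coeffℤ (map -_ (map +_ xs)) h                 ≡⟨ coeffℤ-neg (map +_ xs) h ⟩
  -1ℤ ℤ.^ length (map +_ xs) ℤ.* coeffℤ (map +_ xs) h         ≡⟨ cong₂ (λ n z → -1ℤ ℤ.^ n ℤ.* z) (trans (length-map +_ xs) len) (coeffℤ-map-+ xs h) ⟩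
  -1ℤ ℤ.^ (h + m) ℤ.* + coeff xs h                            ≡⟨ cong (ℤ._* + coeff xs h) (ℤₚ.^-distribˡ-+-* -1ℤ h m) ⟩
  -1ℤ ℤ.^ h ℤ.* -1ℤ ℤ.^ m ℤ.* + coeff xs h                    ≡⟨ ℤₚ.*-assoc (-1ℤ ℤ.^ h) _ _ ⟩
  -1ℤ ℤ.^ h ℤ.* (-1ℤ ℤ.^ m ℤ.* + coeff xs h)                  ∎)
  where open ≡-Reasoning

-- With Q = q^e, the generating function of the C_j(i), in the powers t^(d-j), has
-- the linear factors t + x for x in factors q Q i (d ∸ i).

negatives : (q m : ℕ) → List ℤ
negatives q m = map -_ (map +_ (geometric q 1 m))

positives : (q Q n : ℕ) → List ℤ
positives q Q n = map +_ (geometric q Q n)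

factors : (q Q m n : ℕ) → List ℤ
factors q Q m n = negatives q m ++ positives q Q n

-- `D` stands for 2e and `Q` for q^e; `q^½-split` expresses q^(x + be) = q^x Q^b through the integer
-- square root.
module _ (q : ℕ) .{{q>1 : NonTrivial q}} (Q D : ℕ)
  (q^½-split : ∀ x b → q ^½ (2 * x + b * D) ≡ q ^ x * Q ^ b) where

  -- With m = i - h, b = j - i + h and h′ = d - j - h, all subtractions become sums: i = h + m and d
  -- - i = h′ + b. Each Gaussian coefficient absorbs its share of the power of q by the q-binomial
  -- theorem, with first term 1 or Q, and the sign (-1)^m goes to the negative factors.
  eigenvalue-summand : ∀ h m h′ b →
    ((-1ℤ ℤ.^ m) ℤ.* + (q ^½ (2 * ((m choose 2) + (b choose 2)) + b * D))) ℚ./ 1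
      ℚ.* gaussian q (h′ + b) h′ ℚ.* gaussian q (h + m) h
    ≡ fromℤ (coeffℤ (map -_ (map +_ (geometric q 1 (h + m)))) h ℤ.* coeffℤ (map +_ (geometric q Q (h′ + b))) h′)
  eigenvalue-summand h m h′ b = begin
    fromℤ (S ℤ.* + (q ^½ (2 * ((m choose 2) + (b choose 2)) + b * D))) ℚ.* Γ′ ℚ.* Γ
      ≡⟨ cong (λ z → fromℤ (S ℤ.* + z) ℚ.* Γ′ ℚ.* Γ) power ⟩
    fromℤ (S ℤ.* + (W * W′)) ℚ.* Γ′ ℚ.* Γ
      ≡⟨ cong (λ z → z ℚ.* Γ′ ℚ.* Γ) (trans (fromℤ-* S _) (cong (fromℤ S ℚ.*_) (trans (cong fromℤ (ℤₚ.pos-* W W′)) (fromℤ-* (+ W) (+ W′))))) ⟩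
    fromℤ S ℚ.* (fromℤ (+ W) ℚ.* fromℤ (+ W′)) ℚ.* Γ′ ℚ.* Γ
      ≡⟨ solve 5 (λ s w w′ γ′ γ → s :* (w :* w′) :* γ′ :* γ := s :* (w :* γ) :* (w′ :* γ′)) refl (fromℤ S) (fromℤ (+ W)) (fromℤ (+ W′)) Γ′ Γ ⟩
    fromℤ S ℚ.* (fromℤ (+ W) ℚ.* Γ) ℚ.* (fromℤ (+ W′) ℚ.* Γ′)
      ≡⟨ cong₂ (λ x y → fromℤ S ℚ.* x ℚ.* y) (gaussian-coeff q 1 h m) (gaussian-coeff q Q h′ b) ⟩
    fromℤ S ℚ.* fromℤ (+ E) ℚ.* fromℤ (+ E′)
      ≡⟨ trans (fromℤ-* (S ℤ.* + E) (+ E′)) (cong (ℚ._* fromℤ (+ E′)) (fromℤ-* S (+ E))) ⟨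
    fromℤ (S ℤ.* + E ℤ.* + E′)
      ≡⟨ cong₂ (λ x y → fromℤ (x ℤ.* y)) (coeffℤ-map-neg (geometric q 1 (h + m)) h m (length-geometric q 1 (h + m))) (coeffℤ-map-+ (geometric q Q (h′ + b)) h′) ⟨
    _ ∎
    where
    open ≡-Reasoning
    open +-*-Solver
    S = -1ℤ ℤ.^ m
    Γ = gaussian q (h + m) h
    Γ′ = gaussian q (h′ + b) h′
    W = 1 ^ m * q ^ (m choose 2)
    W′ = Q ^ b * q ^ (b choose 2)
    E = coeff (geometric q 1 (h + m)) h
    E′ = coeff (geometric q Q (h′ + b)) h′
    power : q ^½ (2 * ((m choose 2) + (b choose 2)) + b * D) ≡ W * W′
    power = begin
      q ^½ (2 * ((m choose 2) + (b choose 2)) + b * D)       ≡⟨ q^½-split ((m choose 2) + (b choose 2)) b ⟩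
      q ^ ((m choose 2) + (b choose 2)) * Q ^ b              ≡⟨ cong (_* Q ^ b) (^-distribˡ-+-* q (m choose 2) (b choose 2)) ⟩
      q ^ (m choose 2) * q ^ (b choose 2) * Q ^ b            ≡⟨ lem (q ^ (m choose 2)) (q ^ (b choose 2)) (Q ^ b) ⟩
      1 * q ^ (m choose 2) * (Q ^ b * q ^ (b choose 2))      ≡⟨ cong (λ z → z * q ^ (m choose 2) * (Q ^ b * q ^ (b choose 2))) (^-zeroˡ m) ⟨
      W * W′                                       ∎
      where
      lem : ∀ x y z → x * y * z ≡ 1 * x * (z * y)
      lem = solve-∀

  -- The sum is a Cauchy product restricted to the h where both coefficients can be nonzero: for h <
  -- i - j the second index d - j - h exceeds the degree d - i, and for h > i the first index
  -- exceeds the degree i.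
  eigenvalue-coeffℤ : ∀ {d j i} e → doubled e ≡ D → j ≤ d → i ≤ d →
    eigenvalue d e q j i ≡ fromℤ (coeffℤ (factors q Q i (d ∸ i)) (d ∸ j))
  eigenvalue-coeffℤ {d} {j} {i} e refl j≤d i≤d = begin
    ∑[ (i ∸ j) ⊔ 0 ⋯ k ⊓ i ] f                    ≡⟨ cong (λ lo → ∑[ lo ⋯ k ⊓ i ] f) (⊔-identityʳ (i ∸ j)) ⟩
    ∑[ i ∸ j ⋯ k ⊓ i ] f                          ≡⟨ sumℚ-fromℤ {f = λ l → f (i ∸ j + l)} {g = λ l → g (i ∸ j + l)} (suc (k ⊓ i) ∸ (i ∸ j)) in-window ⟩
    fromℤ (sumℤ (λ l → g (i ∸ j + l)) (suc (k ⊓ i) ∸ (i ∸ j)))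
                                                  ≡⟨ cong fromℤ (sumℤ-window g (i ∸ j) (suc (k ⊓ i)) (suc k) lo≤hi (s≤s (m⊓n≤m k i)) below above) ⟨
    fromℤ (sumℤ g (suc k))                        ≡⟨ cong fromℤ (coeffℤ-++ (negatives q i) (positives q Q (d ∸ i)) k) ⟨
    fromℤ (coeffℤ (factors q Q i (d ∸ i)) k)            ∎
    where
    open ≡-Reasoning
    k = d ∸ j
    f : ℕ → ℚ
    f h = ((-1ℤ ℤ.^ (i ∸ h)) ℤ.* + (q ^½ (2 * (((i ∸ h) choose 2) + ((j + h ∸ i) choose 2)) + (j + h ∸ i) * doubled e))) ℚ./ 1
      ℚ.* gaussian q (d ∸ i) (d ∸ j ∸ h)
      ℚ.* gaussian q i h
    g : ℕ → ℤ
    g h = coeffℤ (negatives q i) h ℤ.* coeffℤ (positives q Q (d ∸ i)) (k ∸ h)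

    lo≤hi : i ∸ j ≤ suc (k ⊓ i)
    lo≤hi = m≤n⇒m≤1+n (⊓-glb (∸-monoˡ-≤ j i≤d) (m∸n≤m i j))

    length-negatives : length (negatives q i) ≡ i
    length-negatives = trans (length-map -_ (map +_ (geometric q 1 i)))
      (trans (length-map +_ (geometric q 1 i)) (length-geometric q 1 i))

    length-positives : length (positives q Q (d ∸ i)) ≡ d ∸ i
    length-positives = trans (length-map +_ (geometric q Q (d ∸ i))) (length-geometric q Q (d ∸ i))

    below : ∀ h → h < i ∸ j → g h ≡ 0ℤ
    below h h<i∸j = trans
      (cong (coeffℤ (negatives q i) h ℤ.*_) (coeffℤ->length (positives q Q (d ∸ i))
        (subst₂ _<_ (sym length-positives) (sym (∸-+-assoc d j h)) (∸-monoʳ-< j+h<i i≤d))))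
      (ℤₚ.*-zeroʳ (coeffℤ (negatives q i) h))
      where
      j+h<i : j + h < i
      j+h<i = ≰⇒> λ i≤j+h → <⇒≱ h<i∸j (m≤n+o⇒m∸n≤o i j i≤j+h)

    above : ∀ h → suc (k ⊓ i) ≤ h → h < suc k → g h ≡ 0ℤ
    above h k⊓i<h (s≤s h≤k) = cong (ℤ._* coeffℤ (positives q Q (d ∸ i)) (k ∸ h))
      (coeffℤ->length (negatives q i) (subst (_< h) (sym length-negatives) i<h))
      where
      i<h : i < h
      i<h = ≰⇒> λ h≤i → <⇒≱ k⊓i<h (⊓-glb h≤k h≤i)

    summand : ∀ h → h ≤ i → h ≤ k → i ≤ j + h → f h ≡ fromℤ (g h)
    summand h h≤i h≤k i≤j+h = subst₂
      (λ x y → ((-1ℤ ℤ.^ m) ℤ.* + (q ^½ (2 * ((m choose 2) + (b choose 2)) + b * doubled e))) ℚ./ 1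
          ℚ.* gaussian q y (k ∸ h) ℚ.* gaussian q x h
        ≡ fromℤ (coeffℤ (map -_ (map +_ (geometric q 1 x))) h ℤ.* coeffℤ (map +_ (geometric q Q y)) (k ∸ h)))
      (m+[n∸m]≡n h≤i) d∸i
      (eigenvalue-summand h m (k ∸ h) b)
      where
      m = i ∸ h
      b = j + h ∸ i
      j+h≤d : j + h ≤ d
      j+h≤d = subst (j + h ≤_) (m+[n∸m]≡n j≤d) (+-monoʳ-≤ j h≤k)
      d∸i : k ∸ h + b ≡ d ∸ i
      d∸i = begin
        k ∸ h + b                    ≡⟨ cong (λ z → z + b) (∸-+-assoc d j h) ⟩
        d ∸ (j + h) + (j + h ∸ i)    ≡⟨ +-∸-assoc (d ∸ (j + h)) i≤j+h ⟨
        d ∸ (j + h) + (j + h) ∸ i    ≡⟨ cong (_∸ i) (m∸n+n≡m j+h≤d) ⟩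
        d ∸ i                        ∎

    in-window : ∀ l → l < suc (k ⊓ i) ∸ (i ∸ j) → f (i ∸ j + l) ≡ fromℤ (g (i ∸ j + l))
    in-window l l< = summand h (≤-trans h≤ (m⊓n≤n k i)) (≤-trans h≤ (m⊓n≤m k i))
      (≤-trans (m≤n+m∸n i j) (+-monoʳ-≤ j (m≤m+n (i ∸ j) l)))
      where
      h = i ∸ j + l
      h≤ : h ≤ k ⊓ i
      h≤ = s≤s⁻¹ (subst (_< suc (k ⊓ i)) (+-comm l (i ∸ j)) (m≤o∸n⇒m+n≤o (suc l) lo≤hi l<))

-- Estimates for symmetric polynomials of geometric progressions

coeff-geometric-growth : ∀ {r} → 2 ≤ r → ∀ c x n → 2 * c ≤ x →
  ∀ h → c * coeff (geometric r x n) (suc h) ≤ coeff (geometric r x n) h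
coeff-geometric-growth {r} 2≤r c x zero    2c≤x zero    = ≤-trans (≤-reflexive (*-zeroʳ c)) z≤n
coeff-geometric-growth {r} 2≤r c x zero    2c≤x (suc h) = ≤-reflexive (*-zeroʳ c)
coeff-geometric-growth {r} 2≤r c x (suc n) 2c≤x h = step h
  where
  open ≤-Reasoning
  t : ℕ → ℕ
  t = coeff (geometric r (x * r) n)
  -- The tail starts at xr, at least 2x, so it satisfies the claim with 2c in place of c. At index 0
  -- the claim reflects that the reciprocals of x, xr, xr², ... sum to less than 2/x.
  IH : ∀ h → 2 * c * t (suc h) ≤ t h
  IH = coeff-geometric-growth 2≤r (2 * c) (x * r) n (≤-trans (*-mono-≤ 2≤r 2c≤x) (≤-reflexive (*-comm r x)))
  c*≤ : ∀ h → c * t (suc h) ≤ t h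
  c*≤ h = ≤-trans (*-monoˡ-≤ (t (suc h)) (m≤m+n c (1 * c))) (IH h)
  lem₁ : ∀ c x y z → 2 * (c * (y + x * z)) ≡ 2 * c * y + x * (2 * c * z)
  lem₁ = solve-∀
  lem₂ : ∀ x y → x * y + x * y ≡ 2 * (x * y)
  lem₂ = solve-∀
  lem₃ : ∀ c x y z → c * (y + x * z) ≡ c * y + x * (c * z)
  lem₃ = solve-∀
  step : ∀ h → c * coeff (geometric r x (suc n)) (suc h) ≤ coeff (geometric r x (suc n)) h
  -- Each of the two terms of the doubled left side is at most x * `t 0`; this uses the hypothesis
  -- 2c ≤ x and the sharper bound `IH`. At higher indices the terms compare one by one.
  step zero = *-cancelˡ-≤ 2 (begin
    2 * (c * (t 0 + x * t 1))            ≡⟨ lem₁ c x (t 0) (t 1) ⟩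
    2 * c * t 0 + x * (2 * c * t 1)      ≤⟨ +-mono-≤ (*-monoˡ-≤ (t 0) 2c≤x) (*-monoʳ-≤ x (IH 0)) ⟩
    x * t 0 + x * t 0                    ≡⟨ lem₂ x (t 0) ⟩
    2 * (x * t 0)                        ∎)
  step (suc h) = begin
    c * (t (suc h) + x * t (2 + h))      ≡⟨ lem₃ c x (t (suc h)) (t (2 + h)) ⟩
    c * t (suc h) + x * (c * t (2 + h))  ≤⟨ +-mono-≤ (c*≤ h) (*-monoʳ-≤ x (c*≤ (suc h))) ⟩
    t h + x * t (suc h)                  ∎

-- The coefficient just below the leading one is the sum of all elements.
head≤coeff-length : ∀ x xs → x ≤ coeff (x ∷ xs) (length xs)
head≤coeff-length x []       = ≤-reflexive (sym (*-identityʳ x))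
head≤coeff-length x (y ∷ ys) = begin
  x                                                         ≡⟨ *-identityʳ x ⟨
  x * 1                                                     ≡⟨ cong (x *_) (coeff-length (y ∷ ys)) ⟨
  x * coeff (y ∷ ys) (suc (length ys))                      ≤⟨ m≤n+m _ (coeff (y ∷ ys) (length ys)) ⟩
  coeff (y ∷ ys) (length ys) + x * coeff (y ∷ ys) (suc (length ys)) ∎
  where open ≤-Reasoning

geometric-scale : ∀ a r c c′ n → a * c ≤ c′ → Pointwise (λ x y → a * x ≤ y) (geometric r c n) (geometric r c′ n)
geometric-scale a r c c′ zero    ac≤c′ = []
geometric-scale a r c c′ (suc n) ac≤c′ = ac≤c′ ∷
  geometric-scale a r (c * r) (c′ * r) n (≤-trans (≤-reflexive (sym (*-assoc a c r))) (*-monoˡ-≤ r ac≤c′))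

-- The factor 1 in the hypothesis matches `geometric-scale` at a = 1.
map-+-∣∣≤ : ∀ {xs ys} → Pointwise (λ x y → 1 * x ≤ y) xs ys → Pointwise (λ x y → ℤ.∣ x ∣ ≤ y) (map +_ xs) ys
map-+-∣∣≤ []               = []
map-+-∣∣≤ {x ∷ _} (r ∷ rs) = ≤-trans (≤-reflexive (sym (*-identityˡ x))) r ∷ map-+-∣∣≤ rs

map-neg-∣∣≤ : ∀ {xs ys} → Pointwise (λ x y → ℤ.∣ x ∣ ≤ y) xs ys → Pointwise (λ x y → ℤ.∣ x ∣ ≤ y) (map -_ xs) ys
map-neg-∣∣≤ []               = []
map-neg-∣∣≤ {x ∷ _} (r ∷ rs) = ≤-trans (≤-reflexive (ℤₚ.∣-i∣≡∣i∣ x)) r ∷ map-neg-∣∣≤ rs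

1*-refl : ∀ c → 1 * c ≤ c
1*-refl c = ≤-reflexive (*-identityˡ c)

-∣z∣≤z : ∀ {z n} → ℤ.∣ z ∣ ≤ n → - (+ n) ℤ.≤ z
-∣z∣≤z {+ m}        _   = ℤₚ.≤-trans (ℤₚ.neg-mono-≤ (ℤ.+≤+ z≤n)) (ℤ.+≤+ z≤n)
-∣z∣≤z {ℤ.-[1+ m ]} m<n = ℤₚ.neg-mono-≤ (ℤ.+≤+ m<n)

-- Size and sign of the coefficients of the generating functions

module _ {q Q : ℕ} where

  -- If Q ≤ q^m, that is e ≤ m, the elements Q, Qq, ... are dominated by the continuation q^m,
  -- q^(m+1), ... of 1, ..., q^(m-1).
  ∣coeffℤ-factors∣≤ : ∀ m n → Q ≤ q ^ m → ∀ k → ℤ.∣ coeffℤ (factors q Q m n) k ∣ ≤ coeff (geometric q 1 (m + n)) k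
  ∣coeffℤ-factors∣≤ m n Q≤q^m k = subst (λ ys → ℤ.∣ coeffℤ (factors q Q m n) k ∣ ≤ coeff ys k)
    (sym (geometric-++ q 1 m n))
    (∣coeffℤ∣≤coeff (++⁺ (map-neg-∣∣≤ (map-+-∣∣≤ (geometric-scale 1 q 1 1 m ≤-refl)))
                         (map-+-∣∣≤ (geometric-scale 1 q Q (1 * q ^ m) n (*-monoʳ-≤ 1 Q≤q^m)))) k)

  coeffℤ-factors-n≡0 : ∀ h m → coeffℤ (factors q Q (h + m) 0) h ≡ -1ℤ ℤ.^ m ℤ.* + coeff (geometric q 1 (h + m)) h
  coeffℤ-factors-n≡0 h m = trans
    (cong (λ xs → coeffℤ xs h) (++-identityʳ (negatives q (h + m))))
    (coeffℤ-map-neg (geometric q 1 (h + m)) h m (length-geometric q 1 (h + m)))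

  coeffℤ-factors-m≡0 : ∀ n k → coeffℤ (factors q Q 0 n) k ≡ + coeff (geometric q Q n) k
  coeffℤ-factors-m≡0 n k = coeffℤ-map-+ (geometric q Q n) k

  ∣coeffℤ-factors-m≡1∣-zero : ∀ n → ℤ.∣ coeffℤ (factors q Q 1 n) 0 ∣ ≡ coeff (geometric q Q n) 0
  ∣coeffℤ-factors-m≡1∣-zero n = begin
    ℤ.∣ -1ℤ ℤ.* coeffℤ (positives q Q n) 0 ∣    ≡⟨ cong (λ z → ℤ.∣ -1ℤ ℤ.* z ∣) (coeffℤ-map-+ (geometric q Q n) 0) ⟩
    ℤ.∣ -1ℤ ℤ.* + coeff (geometric q Q n) 0 ∣   ≡⟨ ℤₚ.abs-* -1ℤ (+ coeff (geometric q Q n) 0) ⟩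
    1 * coeff (geometric q Q n) 0               ≡⟨ *-identityˡ _ ⟩
    coeff (geometric q Q n) 0                   ∎
    where open ≡-Reasoning

  -- Multiplication by t - 1 yields differences of consecutive coefficients; the hypothesis keeps
  -- the natural subtraction from truncating.
  coeffℤ-factors-m≡1-suc : ∀ n k → coeff (geometric q Q n) (suc k) ≤ coeff (geometric q Q n) k →
    coeffℤ (factors q Q 1 n) (suc k) ≡ + (coeff (geometric q Q n) k ∸ coeff (geometric q Q n) (suc k))
  coeffℤ-factors-m≡1-suc n k b≤a = begin
    coeffℤ (positives q Q n) k ℤ.+ -1ℤ ℤ.* coeffℤ (positives q Q n) (suc k)
                                ≡⟨ cong₂ (λ x y → x ℤ.+ -1ℤ ℤ.* y) (coeffℤ-map-+ (geometric q Q n) k) (coeffℤ-map-+ (geometric q Q n) (suc k)) ⟩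
    + a ℤ.+ -1ℤ ℤ.* + b         ≡⟨ cong (λ z → + a ℤ.+ z) (ℤₚ.-1*i≡-i (+ b)) ⟩
    + a ℤ.- + b                 ≡⟨ ℤₚ.m-n≡m⊖n a b ⟩
    a ℤ.⊖ b                     ≡⟨ ℤₚ.⊖-≥ b≤a ⟩
    + (a ∸ b)                   ∎
    where
    open ≡-Reasoning
    a = coeff (geometric q Q n) k
    b = coeff (geometric q Q n) (suc k)

  -- The case e > 1, in the form 2q ≤ Q

  module _ (2≤q : 2 ≤ q) (2q≤Q : 2 * q ≤ Q) where

    private instance
      _ = >-nonZero (≤-trans (s≤s z≤n) 2≤q)

    4≤Q : 4 ≤ Q
    4≤Q = ≤-trans (*-monoʳ-≤ 2 2≤q) 2q≤Q

    growth : ∀ n k → 2 * coeff (geometric q Q n) (suc k) ≤ coeff (geometric q Q n) k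
    growth n = coeff-geometric-growth 2≤q 2 Q n 4≤Q

    coeffℤ-factors-m≡1-nonNeg : ∀ n k → 0ℤ ℤ.≤ coeffℤ (factors q Q 1 n) (suc k)
    coeffℤ-factors-m≡1-nonNeg n k = subst (0ℤ ℤ.≤_)
      (sym (coeffℤ-factors-m≡1-suc n k (≤-trans (m≤m+n _ _) (growth n k)))) (ℤ.+≤+ z≤n)

    -- The elements of factors q Q (suc m) n other than -1 are at most half as
    -- large as the corresponding elements of factors q Q 1 (m + n).
    module _ (m n : ℕ) (1≤m : 1 ≤ m) where

      rest : List ℤ
      rest = map -_ (map +_ (geometric q (1 * q) m)) ++ positives q Q n

      absRest full : List ℕ
      absRest = geometric q (1 * q) m ++ geometric q Q n
      full    = geometric q Q (m + n)

      length-full : length full ≡ m + n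
      length-full = length-geometric q Q (m + n)

      ∣coeffℤ-rest∣≤ : ∀ h → ℤ.∣ coeffℤ rest h ∣ ≤ coeff absRest h
      ∣coeffℤ-rest∣≤ = ∣coeffℤ∣≤coeff
        (++⁺ (map-neg-∣∣≤ (map-+-∣∣≤ (geometric-scale 1 q (1 * q) (1 * q) m (1*-refl _))))
             (map-+-∣∣≤ (geometric-scale 1 q Q Q n (1*-refl _))))

      -- The first m pairs use 2q ≤ Q. In the others the progression from Q is shifted by m ≥ 1
      -- places, which gains q^m ≥ 2.
      absRest-half : Pointwise (λ x y → 2 * x ≤ y) absRest full
      absRest-half = subst (Pointwise (λ x y → 2 * x ≤ y) absRest) (sym (geometric-++ q Q m n))
        (++⁺ (geometric-scale 2 q (1 * q) Q m (subst (λ z → 2 * z ≤ Q) (sym (*-identityˡ q)) 2q≤Q))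
             (geometric-scale 2 q Q (Q * q ^ m) n
               (≤-trans (≤-reflexive (*-comm 2 Q)) (*-monoʳ-≤ Q 2≤q^m))))
        where
        2≤q^m : 2 ≤ q ^ m
        2≤q^m = ≤-trans (≤-trans 2≤q (≤-reflexive (sym (*-identityʳ q)))) (^-monoʳ-≤ q 1≤m)

      -- Here j is the degree of the coefficient as a symmetric polynomial, and each degree gains a
      -- factor 2.
      halving : ∀ h j → h + j ≡ m + n → 2 ^ j * coeff absRest h ≤ coeff full h
      halving h j h+j≡ = *-cancelˡ-≤ (2 ^ h) {{m^n≢0 2 h}} (begin
        2 ^ h * (2 ^ j * coeff absRest h)      ≡⟨ *-assoc (2 ^ h) (2 ^ j) _ ⟨
        2 ^ h * 2 ^ j * coeff absRest h        ≡⟨ cong (_* coeff absRest h) (^-distribˡ-+-* 2 h j) ⟨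
        2 ^ (h + j) * coeff absRest h          ≡⟨ cong (λ l → 2 ^ l * coeff absRest h) (trans h+j≡ (sym length-full)) ⟩
        2 ^ length full * coeff absRest h      ≤⟨ coeff-halving absRest-half h ⟩
        2 ^ h * coeff full h                   ∎)
        where open ≤-Reasoning

      -- In general s ≤ t/4, s′ ≤ t′/2 and t′ ≤ t/2, which add up to exactly t. When t has degree 1
      -- only s ≤ t/2 is available; then t′ = 1 is the leading coefficient, s′ ≤ 1, and t ≥ Q ≥ 4
      -- makes up the rest.
      coeff-dominates : ∀ k j → k + suc j ≡ m + n →
        coeff absRest k + coeff absRest (suc k) + coeff full (suc k) ≤ coeff full k
      coeff-dominates k zero k+1≡ = *-cancelˡ-≤ 2 (begin
        2 * (s + s′ + t′)       ≡⟨ lem s s′ t′ ⟩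
        2 * s + 2 * (s′ + t′)   ≤⟨ +-mono-≤ (halving k 1 k+1≡) (*-monoʳ-≤ 2 (+-monoˡ-≤ t′ s′≤t′)) ⟩
        t + 2 * (t′ + t′)       ≡⟨ cong (λ z → t + 2 * (z + z)) t′≡1 ⟩
        t + 4                   ≤⟨ +-monoʳ-≤ t (≤-trans 4≤Q Q≤t) ⟩
        t + t                   ≡⟨ cong (λ z → t + z) (+-identityʳ t) ⟨
        2 * t                   ∎)
        where
        open ≤-Reasoning
        s = coeff absRest k
        s′ = coeff absRest (suc k)
        t = coeff full k
        t′ = coeff full (suc k)
        1+k≡ : suc k ≡ m + n
        1+k≡ = trans (+-comm 1 k) k+1≡
        s′≤t′ : s′ ≤ t′
        s′≤t′ = subst (_≤ t′) (*-identityˡ s′) (halving (suc k) 0 (trans (+-identityʳ (suc k)) 1+k≡))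
        t′≡1 : t′ ≡ 1
        t′≡1 = trans (cong (coeff full) (trans 1+k≡ (sym length-full))) (coeff-length full)
        Q≤t : Q ≤ t
        Q≤t = subst₂ (λ l h → Q ≤ coeff (geometric q Q l) h) 1+k≡ (length-geometric q (Q * q) k)
          (head≤coeff-length Q (geometric q (Q * q) k))
        lem : ∀ x y z → 2 * (x + y + z) ≡ 2 * x + 2 * (y + z)
        lem = solve-∀
      coeff-dominates k (suc j) k+2+j≡ = *-cancelˡ-≤ 4 (begin
        4 * (s + s′ + t′)               ≡⟨ lem₁ s s′ t′ ⟩
        4 * s + 2 * (2 * s′) + 4 * t′   ≤⟨ +-monoˡ-≤ (4 * t′) (+-mono-≤ 4s≤t (*-monoʳ-≤ 2 2s′≤t′)) ⟩
        t + 2 * t′ + 4 * t′             ≡⟨ lem₂ t t′ ⟩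
        t + 3 * (2 * t′)                ≤⟨ +-monoʳ-≤ t (*-monoʳ-≤ 3 (growth (m + n) k)) ⟩
        4 * t                           ∎)
        where
        open ≤-Reasoning
        s = coeff absRest k
        s′ = coeff absRest (suc k)
        t = coeff full k
        t′ = coeff full (suc k)
        4s≤t : 4 * s ≤ t
        4s≤t = ≤-trans (*-monoˡ-≤ s (^-monoʳ-≤ 2 {2} {suc (suc j)} (s≤s (s≤s z≤n)))) (halving k (suc (suc j)) k+2+j≡)
        2s′≤t′ : 2 * s′ ≤ t′
        2s′≤t′ = ≤-trans (*-monoˡ-≤ s′ (^-monoʳ-≤ 2 {1} {suc j} (s≤s z≤n))) (halving (suc k) (suc j) (trans (sym (+-suc k (suc j))) k+2+j≡))
        lem₁ : ∀ x y z → 4 * (x + y + z) ≡ 4 * x + 2 * (2 * y) + 4 * z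
        lem₁ = solve-∀
        lem₂ : ∀ x y → x + 2 * y + 4 * y ≡ x + 3 * (2 * y)
        lem₂ = solve-∀

      -- Both polynomials contain the factor t - 1. On the left the resulting difference is
      -- estimated by the triangle inequality, on the right it is a known nonnegative number, and
      -- `coeff-dominates` compares the two. At k = 0 both sides are plain products.
      ∣coeffℤ-factors∣≤∣coeffℤ-factors-1∣ : ∀ k j → k + suc j ≡ suc (m + n) →
        ℤ.∣ coeffℤ (factors q Q (suc m) n) k ∣ ≤ ℤ.∣ coeffℤ (factors q Q 1 (m + n)) k ∣
      ∣coeffℤ-factors∣≤∣coeffℤ-factors-1∣ zero j eq = begin
        ℤ.∣ -1ℤ ℤ.* coeffℤ rest 0 ∣               ≡⟨ trans (ℤₚ.abs-* -1ℤ (coeffℤ rest 0)) (*-identityˡ _) ⟩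
        ℤ.∣ coeffℤ rest 0 ∣                       ≤⟨ ∣coeffℤ-rest∣≤ 0 ⟩
        coeff absRest 0                           ≤⟨ m≤n*m (coeff absRest 0) (2 ^ (m + n)) {{m^n≢0 2 (m + n)}} ⟩
        2 ^ (m + n) * coeff absRest 0             ≤⟨ halving 0 (m + n) refl ⟩
        coeff full 0                              ≡⟨ ∣coeffℤ-factors-m≡1∣-zero (m + n) ⟨
        ℤ.∣ coeffℤ (factors q Q 1 (m + n)) 0 ∣    ∎
        where open ≤-Reasoning
      ∣coeffℤ-factors∣≤∣coeffℤ-factors-1∣ (suc k) j eq = begin
        ℤ.∣ coeffℤ rest k ℤ.+ -1ℤ ℤ.* coeffℤ rest (suc k) ∣         ≤⟨ ℤₚ.∣i+j∣≤∣i∣+∣j∣ (coeffℤ rest k) _ ⟩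
        ℤ.∣ coeffℤ rest k ∣ + ℤ.∣ -1ℤ ℤ.* coeffℤ rest (suc k) ∣     ≡⟨ cong (λ z → ℤ.∣ coeffℤ rest k ∣ + z) (trans (ℤₚ.abs-* -1ℤ (coeffℤ rest (suc k))) (*-identityˡ _)) ⟩
        ℤ.∣ coeffℤ rest k ∣ + ℤ.∣ coeffℤ rest (suc k) ∣             ≤⟨ +-mono-≤ (∣coeffℤ-rest∣≤ k) (∣coeffℤ-rest∣≤ (suc k)) ⟩
        coeff absRest k + coeff absRest (suc k)                     ≤⟨ m+n≤o⇒m≤o∸n _ (coeff-dominates k j (suc-injective eq)) ⟩
        coeff full k ∸ coeff full (suc k)                           ≡⟨ cong ℤ.∣_∣ (coeffℤ-factors-m≡1-suc (m + n) k (≤-trans (m≤m+n _ _) (growth (m + n) k))) ⟨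
        ℤ.∣ coeffℤ (factors q Q 1 (m + n)) (suc k) ∣                ∎
        where open ≤-Reasoning

-- The power Q = q^e and its size relative to q

record HalfPower (e : ℚ) (q : ℕ) : Set where
  field
    Q         : ℕ
    split     : ∀ x b → q ^½ (2 * x + b * doubled e) ≡ q ^ x * Q ^ b
    Q≤q²      : Q ≤ q ^ 2
    e≤1⇒Q≤q  : e ℚ.≤ 1ℚ → Q ≤ q
    1<e⇒2q≤Q : 1ℚ ℚ.< e → 2 * q ≤ Q
    e≡1⇒Q≡q  : e ≡ 1ℚ → Q ≡ q

^½-split-integral : ∀ q k x b → q ^½ (2 * x + b * (2 * k)) ≡ q ^ x * (q ^ k) ^ b
^½-split-integral q k x b = begin
  q ^½ (2 * x + b * (2 * k))   ≡⟨ cong (q ^½_) (lem x b k) ⟩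
  q ^½ (2 * (x + k * b))       ≡⟨ ^½-even q (x + k * b) ⟩
  q ^ (x + k * b)              ≡⟨ ^-distribˡ-+-* q x (k * b) ⟩
  q ^ x * q ^ (k * b)          ≡⟨ cong (q ^ x *_) (^-*-assoc q k b) ⟨
  q ^ x * (q ^ k) ^ b          ∎
  where
  open ≡-Reasoning
  lem : ∀ x b k → 2 * x + b * (2 * k) ≡ 2 * (x + k * b)
  lem = solve-∀

^½-split-square : ∀ r k x b → (r ^ 2) ^½ (2 * x + b * k) ≡ (r ^ 2) ^ x * (r ^ k) ^ b
^½-split-square r k x b = begin
  (r ^ 2) ^½ (2 * x + b * k)   ≡⟨ ^½-square r (2 * x + b * k) ⟩
  r ^ (2 * x + b * k)          ≡⟨ ^-distribˡ-+-* r (2 * x) (b * k) ⟩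
  r ^ (2 * x) * r ^ (b * k)    ≡⟨ cong₂ _*_ (^-*-assoc r 2 x) (trans (^-*-assoc r k b) (cong (r ^_) (*-comm k b))) ⟨
  (r ^ 2) ^ x * (r ^ k) ^ b    ∎
  where open ≡-Reasoning

-- The cases are e = 0, ½, 1, 3/2, 2 in this order. For integral e, Q is q^e; otherwise q = r² and Q
-- = r^(2e). Implications whose premise fails at the given e are refuted by deciding the comparison.
halfPower : ∀ {e} → e ∈ polarParameters → ∀ {q} → 2 ≤ q →
  (e ∈ (½ ∷ 3/2 ∷ []) → IsSquareOfPrimePower q) → HalfPower e q
halfPower (here refl) {q} 2≤q _ = record
  { Q         = q ^ 0
  ; split     = ^½-split-integral q 0
  ; Q≤q²      = ^-monoʳ-≤ q {0} {2} z≤n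
  ; e≤1⇒Q≤q  = λ _ → <⇒≤ 2≤q
  ; 1<e⇒2q≤Q = λ 1<e → contradiction 1<e (from-no (1ℚ ℚ.<? 0ℚ))
  ; e≡1⇒Q≡q  = λ e≡1 → contradiction e≡1 (from-no (0ℚ ℚ.≟ 1ℚ))
  }
  where instance _ = >-nonZero (≤-trans (s≤s z≤n) 2≤q)
halfPower (there (here refl)) 2≤q sq with sq (here refl)
... | r , r-pp , refl = record
  { Q         = r ^ 1
  ; split     = ^½-split-square r 1
  ; Q≤q²      = ≤-trans r≤q (subst (r ^ 2 ≤_) (sym (^-*-assoc r 2 2)) (^-monoʳ-≤ r {2} {4} (s≤s (s≤s z≤n))))
  ; e≤1⇒Q≤q  = λ _ → r≤q
  ; 1<e⇒2q≤Q = λ 1<e → contradiction 1<e (from-no (1ℚ ℚ.<? ½))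
  ; e≡1⇒Q≡q  = λ e≡1 → contradiction e≡1 (from-no (½ ℚ.≟ 1ℚ))
  }
  where
  instance _ = nonTrivial⇒nonZero r {{isPrimePower⇒nonTrivial r-pp}}
  r≤q : r ^ 1 ≤ r ^ 2
  r≤q = ^-monoʳ-≤ r {1} {2} (s≤s z≤n)
halfPower (there (there (here refl))) {q} 2≤q _ = record
  { Q         = q ^ 1
  ; split     = ^½-split-integral q 1
  ; Q≤q²      = ^-monoʳ-≤ q {1} {2} (s≤s z≤n)
  ; e≤1⇒Q≤q  = λ _ → ≤-reflexive (*-identityʳ q)
  ; 1<e⇒2q≤Q = λ 1<e → contradiction 1<e (from-no (1ℚ ℚ.<? 1ℚ))
  ; e≡1⇒Q≡q  = λ _ → *-identityʳ q
  }
  where instance _ = >-nonZero (≤-trans (s≤s z≤n) 2≤q)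
halfPower (there (there (there (here refl)))) 2≤q sq with sq (there (here refl))
... | r , r-pp , refl = record
  { Q         = r ^ 3
  ; split     = ^½-split-square r 3
  ; Q≤q²      = subst (r ^ 3 ≤_) (sym (^-*-assoc r 2 2)) (^-monoʳ-≤ r {3} {4} (s≤s (s≤s (s≤s z≤n))))
  ; e≤1⇒Q≤q  = λ e≤1 → contradiction e≤1 (from-no (3/2 ℚ.≤? 1ℚ))
  -- With q = r² and Q = r · r², the claim reduces to 2 ≤ r.
  ; 1<e⇒2q≤Q = λ _ → *-monoˡ-≤ (r ^ 2) (nonTrivial⇒n>1 r {{isPrimePower⇒nonTrivial r-pp}})
  ; e≡1⇒Q≡q  = λ e≡1 → contradiction e≡1 (from-no (3/2 ℚ.≟ 1ℚ))
  }
  where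
  instance _ = nonTrivial⇒nonZero r {{isPrimePower⇒nonTrivial r-pp}}
halfPower (there (there (there (there (here refl))))) {q} 2≤q _ = record
  { Q         = q ^ 2
  ; split     = ^½-split-integral q 2
  ; Q≤q²      = ≤-refl
  ; e≤1⇒Q≤q  = λ e≤1 → contradiction e≤1 (from-no (2ℚ ℚ.≤? 1ℚ))
  ; 1<e⇒2q≤Q = λ _ → *-mono-≤ 2≤q (≤-reflexive (sym (*-identityʳ q)))
  ; e≡1⇒Q≡q  = λ e≡1 → contradiction e≡1 (from-no (2ℚ ℚ.≟ 1ℚ))
  }

-- Comparison of the integers C_j(i) for fixed j

-1^odd : ∀ n → ¬ (2 ∣ n) → -1ℤ ℤ.^ n ≡ -1ℤ
-1^odd zero          2∤n = contradiction (divides 0 refl) 2∤n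
-1^odd (suc zero)    2∤n = refl
-1^odd (suc (suc n)) 2∤n = trans (lem (-1ℤ ℤ.^ n)) (-1^odd n λ { (divides k eq) → 2∤n (divides (suc k) (cong (λ z → 2 + z) eq)) })
  where
  lem : ∀ p → -1ℤ ℤ.* (-1ℤ ℤ.* p) ≡ p
  lem = ℤ-Solver.solve-∀

∣fromℤ∣-mono-≤ : ∀ {x y} → ℤ.∣ x ∣ ≤ ℤ.∣ y ∣ → ℚ.∣ fromℤ x ∣ ℚ.≤ ℚ.∣ fromℤ y ∣
∣fromℤ∣-mono-≤ {x} {y} le = subst₂ ℚ._≤_ (sym (∣fromℤ∣ x)) (sym (∣fromℤ∣ y)) (fromℤ-mono-≤ (ℤ.+≤+ le))

module _ {q Q d j : ℕ} (j≤d : j ≤ d) where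

  private
    k : ℕ
    k = d ∸ j

    c : ℕ → ℤ
    c i = coeffℤ (factors q Q i (d ∸ i)) k

    -- The elementary symmetric polynomial of degree j at 1, q, ..., q^(d-1), which is the absolute
    -- value of C_j(d).
    top : ℕ
    top = coeff (geometric q 1 d) k

  ∣c∣≤top : ∀ {i} → i ≤ d → Q ≤ q ^ i → ℤ.∣ c i ∣ ≤ top
  ∣c∣≤top {i} i≤d Q≤q^i = subst (λ l → ℤ.∣ c i ∣ ≤ coeff (geometric q 1 l) k) (m+[n∸m]≡n i≤d)
    (∣coeffℤ-factors∣≤ i (d ∸ i) Q≤q^i k)

  c[d]≡±top : c d ≡ -1ℤ ℤ.^ j ℤ.* + top
  c[d]≡±top = trans (cong (λ l → coeffℤ (factors q Q d l) k) (n∸n≡0 d))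
    (subst (λ l → coeffℤ (factors q Q l 0) k ≡ -1ℤ ℤ.^ j ℤ.* + coeff (geometric q 1 l) k) (m∸n+n≡m j≤d)
      (coeffℤ-factors-n≡0 {Q = Q} k j))

  ∣c∣≤∣c[d]∣ : ∀ {i} → i ≤ d → Q ≤ q ^ i → ℤ.∣ c i ∣ ≤ ℤ.∣ c d ∣
  ∣c∣≤∣c[d]∣ {i} i≤d Q≤q^i = subst (ℤ.∣ c i ∣ ≤_)
    (sym (trans (cong ℤ.∣_∣ c[d]≡±top) (∣-1^n*z∣≡∣z∣ j (+ top)))) (∣c∣≤top i≤d Q≤q^i)

  module _ (2∤j : ¬ (2 ∣ j)) where

    c[d]≡-top : c d ≡ - (+ top)
    c[d]≡-top = trans c[d]≡±top (trans (cong (ℤ._* + top) (-1^odd j 2∤j)) (ℤₚ.-1*i≡-i (+ top)))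

    c[d]≤c : ∀ {i} → i ≤ d → Q ≤ q ^ i → c d ℤ.≤ c i
    c[d]≤c {i} i≤d Q≤q^i = subst (ℤ._≤ c i) (sym c[d]≡-top) (-∣z∣≤z (∣c∣≤top i≤d Q≤q^i))

    -- For odd j the value at d is -`top`, hence at most 0.
    c[d]≤nonNeg : ∀ {z} → 0ℤ ℤ.≤ z → c d ℤ.≤ z
    c[d]≤nonNeg {z} = ℤₚ.≤-trans (subst (ℤ._≤ 0ℤ) (sym c[d]≡-top) (ℤₚ.neg-mono-≤ (ℤ.+≤+ z≤n)))

    c[d]≤c[0] : c d ℤ.≤ c 0
    c[d]≤c[0] = c[d]≤nonNeg (subst (0ℤ ℤ.≤_) (sym (coeffℤ-factors-m≡0 d k)) (ℤ.+≤+ z≤n))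

    -- Since j < d, the index k is positive and C_j(1) is a nonnegative difference; at k = 0 it
    -- would be a product containing the factor -1.
    c[d]≤c[1] : 2 ≤ q → 2 * q ≤ Q → j < d → c d ℤ.≤ c 1
    c[d]≤c[1] 2≤q 2q≤Q j<d = c[d]≤nonNeg (subst (λ h → 0ℤ ℤ.≤ coeffℤ (factors q Q 1 (d ∸ 1)) h)
      (m+[n∸m]≡n (m<n⇒0<n∸m j<d)) (coeffℤ-factors-m≡1-nonNeg 2≤q 2q≤Q (d ∸ 1) (k ∸ 1)))

  ∣c∣≤∣c[1]∣ : ∀ {i} → 2 ≤ q → 1 ≤ j → 2 * q ≤ Q → 1 ≤ i → i ≤ d → ℤ.∣ c i ∣ ≤ ℤ.∣ c 1 ∣
  ∣c∣≤∣c[1]∣ {suc zero}      2≤q 1≤j 2q≤Q 1≤i i≤d = ≤-refl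
  ∣c∣≤∣c[1]∣ {suc m@(suc _)} 2≤q 1≤j 2q≤Q 1≤i i≤d =
    subst (λ l → ℤ.∣ c (suc m) ∣ ≤ ℤ.∣ coeffℤ (factors q Q 1 l) k ∣) m+n≡d-1
      (∣coeffℤ-factors∣≤∣coeffℤ-factors-1∣ 2≤q 2q≤Q m (d ∸ suc m) (s≤s z≤n) k (j ∸ 1) k+j≡)
    where
    m+n≡d-1 : m + (d ∸ suc m) ≡ d ∸ 1
    m+n≡d-1 = cong (_∸ 1) (m+[n∸m]≡n i≤d)
    k+j≡ : k + suc (j ∸ 1) ≡ suc m + (d ∸ suc m)
    k+j≡ = trans (cong (λ z → k + z) (m+[n∸m]≡n 1≤j)) (trans (m∸n+n≡m j≤d) (sym (m+[n∸m]≡n i≤d)))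

  -- For j = d the coefficients are constant terms, and with Q = q both are, up to sign, the product
  -- of 1, q, ..., q^(d-1).
  ∣c[d]∣≤∣c[1]∣ : 1 ≤ q → 1 ≤ j → j ≡ d → Q ≡ q → ℤ.∣ c d ∣ ≤ ℤ.∣ c 1 ∣
  ∣c[d]∣≤∣c[1]∣ 1≤q 1≤j refl refl = begin
    ℤ.∣ c d ∣                                       ≤⟨ ∣c∣≤top ≤-refl q≤q^d ⟩
    coeff (geometric q 1 d) k                       ≡⟨ cong₂ (λ l h → coeff (geometric q 1 l) h) (m+[n∸m]≡n 1≤j) (sym k≡0) ⟨
    coeff (geometric q 1 (suc (d ∸ 1))) 0           ≡⟨ *-identityˡ _ ⟩
    coeff (geometric q (1 * q) (d ∸ 1)) 0           ≡⟨ cong (λ r → coeff (geometric q r (d ∸ 1)) 0) (*-identityˡ q) ⟩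
    coeff (geometric q q (d ∸ 1)) 0                 ≡⟨ ∣coeffℤ-factors-m≡1∣-zero (d ∸ 1) ⟨
    ℤ.∣ coeffℤ (factors q q 1 (d ∸ 1)) 0 ∣          ≡⟨ cong (λ h → ℤ.∣ coeffℤ (factors q q 1 (d ∸ 1)) h ∣) k≡0 ⟨
    ℤ.∣ c 1 ∣                                       ∎
    where
    open ≤-Reasoning
    instance _ = >-nonZero 1≤q
    k≡0 : k ≡ 0
    k≡0 = n∸n≡0 d
    q≤q^d : q ≤ q ^ d
    q≤q^d = ≤-trans (≤-reflexive (sym (*-identityʳ q))) (^-monoʳ-≤ q 1≤j)

-- Extremal values among the rational eigenvalues

corollary6p5 : (d j : ℕ) → 3 ≤ d → 1 ≤ j → j ≤ d →
    (e : ℚ) → e ∈ polarParameters →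
    (q : ℕ) (pp : IsPrimePower q) →
    (e ∈ (½ ∷ 3/2 ∷ []) → IsSquareOfPrimePower q) →
    let C = eigenvalue d e q {{isPrimePower⇒nonTrivial pp}} j in
    ((1ℚ ℚ.< e ⊎ (j ≡ d × e ≡ 1ℚ)) → IsMax (Values (λ i → ∣ C i ∣) 1 d) ∣ C 1 ∣)
    × (e ℚ.≤ 1ℚ → IsMax (Values (λ i → ∣ C i ∣) 1 d) ∣ C d ∣)
    × (j < d → ¬ (2 ∣ j) → IsMin (Values C 0 d) (C d))
corollary6p5 d j 3≤d 1≤j j≤d e e∈ q pp sq = part-i , part-ii , part-iii
  where
  instance q>1 = isPrimePower⇒nonTrivial pp
  2≤q : 2 ≤ q
  2≤q = nonTrivial⇒n>1 q
  instance _ = >-nonZero (≤-trans (s≤s z≤n) 2≤q)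
  open HalfPower (halfPower e∈ 2≤q sq)

  C : ℕ → ℚ
  C = eigenvalue d e q j

  c : ℕ → ℤ
  c i = coeffℤ (factors q Q i (d ∸ i)) (d ∸ j)

  C≡c : ∀ {i} → i ≤ d → C i ≡ fromℤ (c i)
  C≡c = eigenvalue-coeffℤ q Q (doubled e) split e refl j≤d

  1≤d : 1 ≤ d
  1≤d = ≤-trans 1≤j j≤d

  ∣C∣-mono : ∀ {i i′} → i ≤ d → i′ ≤ d → ℤ.∣ c i ∣ ≤ ℤ.∣ c i′ ∣ → ∣ C i ∣ ℚ.≤ ∣ C i′ ∣
  ∣C∣-mono {i} {i′} i≤d i′≤d le = subst₂ (λ x y → ∣ x ∣ ℚ.≤ ∣ y ∣) (sym (C≡c i≤d)) (sym (C≡c i′≤d))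
    (∣fromℤ∣-mono-≤ {c i} {c i′} le)

  C-mono : ∀ {i i′} → i ≤ d → i′ ≤ d → c i ℤ.≤ c i′ → C i ℚ.≤ C i′
  C-mono i≤d i′≤d le = subst₂ ℚ._≤_ (sym (C≡c i≤d)) (sym (C≡c i′≤d)) (fromℤ-mono-≤ le)

  Q≤q⇒Q≤q^ : ∀ {i} → 1 ≤ i → Q ≤ q → Q ≤ q ^ i
  Q≤q⇒Q≤q^ 1≤i Q≤q = ≤-trans Q≤q (≤-trans (≤-reflexive (sym (*-identityʳ q))) (^-monoʳ-≤ q 1≤i))

  part-i : (1ℚ ℚ.< e ⊎ (j ≡ d × e ≡ 1ℚ)) → IsMax (Values (λ i → ∣ C i ∣) 1 d) ∣ C 1 ∣
  part-i cond = (1 , ≤-refl , 1≤d , refl) , λ { x (i , 1≤i , i≤d , refl) → ∣C∣-mono i≤d 1≤d (bound cond 1≤i i≤d) }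
    where
    bound : (1ℚ ℚ.< e ⊎ (j ≡ d × e ≡ 1ℚ)) → ∀ {i} → 1 ≤ i → i ≤ d → ℤ.∣ c i ∣ ≤ ℤ.∣ c 1 ∣
    bound (inj₁ 1<e)         1≤i i≤d = ∣c∣≤∣c[1]∣ j≤d 2≤q 1≤j (1<e⇒2q≤Q 1<e) 1≤i i≤d
    -- At e = 1 every value is dominated by the one at d, and for j = d that one is dominated by the
    -- value at 1.
    bound (inj₂ (j≡d , e≡1)) 1≤i i≤d = ≤-trans
      (∣c∣≤∣c[d]∣ j≤d i≤d (Q≤q⇒Q≤q^ 1≤i (≤-reflexive (e≡1⇒Q≡q e≡1))))
      (∣c[d]∣≤∣c[1]∣ j≤d (<⇒≤ 2≤q) 1≤j j≡d (e≡1⇒Q≡q e≡1))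

  part-ii : e ℚ.≤ 1ℚ → IsMax (Values (λ i → ∣ C i ∣) 1 d) ∣ C d ∣
  part-ii e≤1 = (d , 1≤d , ≤-refl , refl) , λ { x (i , 1≤i , i≤d , refl) →
    ∣C∣-mono i≤d ≤-refl (∣c∣≤∣c[d]∣ j≤d i≤d (Q≤q⇒Q≤q^ 1≤i (e≤1⇒Q≤q e≤1))) }

  part-iii : j < d → ¬ (2 ∣ j) → IsMin (Values C 0 d) (C d)
  part-iii j<d 2∤j = (d , z≤n , ≤-refl , refl) , λ { x (i , _ , i≤d , refl) → C-mono ≤-refl i≤d (bound i i≤d) }
    where
    bound : ∀ i → i ≤ d → c d ℤ.≤ c i
    bound zero            i≤d = c[d]≤c[0] j≤d 2∤j
    -- Only i = 1 depends on e: if e ≤ 1 then q^e ≤ q^i and the general bound applies, otherwise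
    -- nonnegativity of C_j(1) does the work.
    bound (suc zero)      i≤d with e ℚ.≤? 1ℚ
    ... | yes e≤1 = c[d]≤c j≤d 2∤j i≤d (Q≤q⇒Q≤q^ {1} (s≤s z≤n) (e≤1⇒Q≤q e≤1))
    ... | no  e≰1 = c[d]≤c[1] j≤d 2∤j 2≤q (1<e⇒2q≤Q (ℚₚ.≰⇒> e≰1)) j<d
    -- For i ≥ 2 the condition e ≤ i holds for every parameter, as e ≤ 2.
    bound (suc (suc i))   i≤d = c[d]≤c j≤d 2∤j i≤d
      (≤-trans Q≤q² (^-monoʳ-≤ q {2} {2 + i} (s≤s (s≤s z≤n))))
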